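{- Fix an integer $k\ge2$ and $\alpha\in(1/2,1]$. There is a finite-support instance of the non-reusable batched Pandora's Box problem with setup cost $T=1$ and batch capacity $k$, whose boxes are $A,D_1,\dots,D_k,B$ with $D_1,\dots,D_k$ identical (independent copies of one box type), such that the (decreasing) reservation-value order is $$A\succ D_1\succeq\cdots\succeq D_k\succ B,$$ and every consecutive-batch policy $\pi$ (with respect to this order) satisfies $\operatorname{val}_\alpha(\pi)\le0$, while $\operatorname{OPT}_1>0$. Consequently, no algorithm restricted to consecutive batches in this order can guarantee an $(\alpha,\alpha)$-bicriteria approximation for any $\alpha>1/2$.
   Context: Non-reusable Batched Pandora's Box, $\mathsf{BP}(T,k)$: there are finitely many boxes; box $i$ has an independent non-negative random reward $V_i$ and an opening cost $c_i\ge 0$; $T\ge0$ is a setup cost and $k$ the batch capacity. A feasible batch is a nonempty set $S$ of currently unopened boxes with $|S|\le k$. Opening $S$ costs $T+\sum_{i\in S}c_i$, reveals $(V_i)_{i\in S}$ simultaneously, and consumes all boxes of $S$. An adaptive policy $\pi$ repeatedly decides, based on what it has observed so far, to stop or to open a further feasible batch. $M_\pi$ is the maximum reward observed ($0$ if no box is opened), $C_\pi$ the total cost paid, $\operatorname{val}_\lambda(\pi)=\mathbb{E}[M_\pi]-\lambda\mathbb{E}[C_\pi]$, and $\operatorname{OPT}_1$ is the maximum of $\operatorname{val}_1$ over all adaptive policies (including the empty one, of value $0$). Boxes are sorted by decreasing individual reservation value computed with item costs only: $\sigma_i$ is defined by $\mathbb{E}[(V_i-\sigma_i)^+]=c_i$;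 $\succ$ means strictly larger and $\succeq$ means at least as large reservation value. Given an ordering of the boxes, a consecutive-batch policy is a policy that only opens batches that are intervals in the current remaining order (the order restricted to the unopened boxes). An $(\alpha,\lambda)$-bicriteria approximation guarantee means: for every $\varepsilon>0$ the algorithm returns a policy $\widehat\pi$ with $\operatorname{val}_\lambda(\widehat\pi)\ge\alpha\operatorname{OPT}_1-\varepsilon$. -}

module Defs where

open import Data.Bool.Base using (true; false)
open import Data.Fin.Base as Fin using (Fin)
open import Data.Fin.Subset using (Subset; _∈_; _⊆_; _─_; ∣_∣; Nonempty; ⊤)
open import Data.Nat.Base as ℕ using (ℕ)
import Data.Nat.Properties as ℕ
open import Data.Product.Base using (Σ-syntax; ∃-syntax; _×_; _,_)
open import Data.Rational.Base as ℚ
  using (ℚ; 0ℚ; 1ℚ; Positive; positive; nonNegative)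
import Data.Rational.Properties as ℚ
open import Data.Rational.Solver using (module +-*-Solver)
open import Data.Unit.Base using (tt) renaming (⊤ to Unit)
open import Data.Vec.Base using (Vec; []; _∷_; lookup)
open import Data.Vec.Relation.Unary.All using (All; []; _∷_)
open import Function.Base using (_∘_)
open import Function.Definitions using (Injective)
open import Relation.Binary.PropositionalEquality
  using (_≡_; refl; sym; trans; cong; cong₂; subst)

open import Algebra.Properties.CommutativeMonoid.Sum ℚ.+-0-commutativeMonoid
  using (sum)

private
  variable
    n k : ℕ

------------------------------------------------------------------------
-- Real numbers, as Cauchy sequences of rationals.  Equality of reals is
-- _≃_, not propositional equality.

record ℝ : Set where
  field
    seq    : ℕ → ℚ
    cauchy : ∀ ε → 0ℚ ℚ.< ε →
             ∃[ N ] (∀ i j → N ℕ.≤ i → N ℕ.≤ j → ℚ.∣ seq i ℚ.- seq j ∣ ℚ.≤ ε)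

open ℝ public

infix 4 _<_ _≤_ _≃_

_<_ : ℝ → ℝ → Set
x < y = ∃[ δ ] (0ℚ ℚ.< δ × ∃[ N ] (∀ i → N ℕ.≤ i → seq x i ℚ.+ δ ℚ.≤ seq y i))

_≤_ : ℝ → ℝ → Set
x ≤ y = ∀ δ → 0ℚ ℚ.< δ → ∃[ N ] (∀ i → N ℕ.≤ i → seq x i ℚ.≤ seq y i ℚ.+ δ)

_≃_ : ℝ → ℝ → Set
x ≃ y = x ≤ y × y ≤ x

fromℚ : ℚ → ℝ
fromℚ q = record
  { seq    = λ _ → q
  ; cauchy = λ ε 0<ε → 0 , λ _ _ _ _ →
      subst (λ r → ℚ.∣ r ∣ ℚ.≤ ε) (sym (ℚ.+-inverseʳ q)) (ℚ.<⇒≤ 0<ε)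
  }

0ℝ 1ℝ : ℝ
0ℝ = fromℚ 0ℚ
1ℝ = fromℚ 1ℚ

private
  open ℚ.≤-Reasoning hiding (stop)

  half-+ : ∀ ε → ℚ.½ ℚ.* ε ℚ.+ ℚ.½ ℚ.* ε ≡ ε
  half-+ ε = trans (sym (ℚ.*-distribʳ-+ ε ℚ.½ ℚ.½)) (ℚ.*-identityˡ ε)

  half-pos : ∀ {ε} → 0ℚ ℚ.< ε → 0ℚ ℚ.< ℚ.½ ℚ.* ε
  half-pos {ε} 0<ε = ℚ.positive⁻¹ (ℚ.½ ℚ.* ε)
    {{ℚ.pos*pos⇒pos ℚ.½ ε {{positive 0<ε}}}}

  bounded : ∀ x → ∃[ B ] (0ℚ ℚ.< B ×
              ∃[ N ] (∀ i → N ℕ.≤ i → ℚ.∣ seq x i ∣ ℚ.≤ B))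
  bounded x with cauchy x 1ℚ (ℚ.positive⁻¹ 1ℚ)
  ... | N , close = 1ℚ ℚ.+ ℚ.∣ xN ∣
      , ℚ.+-mono-<-≤ (ℚ.positive⁻¹ 1ℚ) (ℚ.0≤∣p∣ xN)
      , N , λ i N≤i → begin
          ℚ.∣ seq x i ∣
            ≡⟨ cong ℚ.∣_∣ (split (seq x i) xN) ⟩
          ℚ.∣ (seq x i ℚ.- xN) ℚ.+ xN ∣
            ≤⟨ ℚ.∣p+q∣≤∣p∣+∣q∣ (seq x i ℚ.- xN) xN ⟩
          ℚ.∣ seq x i ℚ.- xN ∣ ℚ.+ ℚ.∣ xN ∣
            ≤⟨ ℚ.+-monoˡ-≤ ℚ.∣ xN ∣ (close i N N≤i ℕ.≤-refl) ⟩
          1ℚ ℚ.+ ℚ.∣ xN ∣ ∎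
    where
    xN = seq x N
    open +-*-Solver
    split : ∀ a b → a ≡ (a ℚ.- b) ℚ.+ b
    split = solve 2 (λ a b → a := (a :- b) :+ b) refl

  *-mono : ∀ {a b c d} → 0ℚ ℚ.≤ b → 0ℚ ℚ.≤ c →
           a ℚ.≤ c → b ℚ.≤ d → a ℚ.* b ℚ.≤ c ℚ.* d
  *-mono {a} {b} {c} {d} 0≤b 0≤c a≤c b≤d = ℚ.≤-trans
    (ℚ.*-monoʳ-≤-nonNeg b {{nonNegative 0≤b}} a≤c)
    (ℚ.*-monoˡ-≤-nonNeg c {{nonNegative 0≤c}} b≤d)

  divide : ∀ B ε → 0ℚ ℚ.< B → 0ℚ ℚ.< ε → ∃[ δ ] (0ℚ ℚ.< δ × B ℚ.* δ ≡ ε)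
  divide B ε 0<B 0<ε =
      (ℚ.1/ B) ℚ.* ε
    , ℚ.positive⁻¹ _ {{ℚ.pos*pos⇒pos (ℚ.1/ B) {{ℚ.1/pos⇒pos B}} ε {{positive 0<ε}}}}
    , trans (sym (ℚ.*-assoc B (ℚ.1/ B) ε))
        (trans (cong (ℚ._* ε) (ℚ.*-inverseʳ B)) (ℚ.*-identityˡ ε))
    where
    instance
      B⁺ : Positive B
      B⁺ = positive 0<B
      B≢0 : ℚ.NonZero B
      B≢0 = ℚ.pos⇒nonZero B

infixl 6 _-_
infixl 7 _*_

_-_ : ℝ → ℝ → ℝ
x - y = record
  { seq    = λ i → seq x i ℚ.- seq y i
  ; cauchy = λ ε 0<ε →
      let (N , cx) = cauchy x (ℚ.½ ℚ.* ε) (half-pos 0<ε)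
          (M , cy) = cauchy y (ℚ.½ ℚ.* ε) (half-pos 0<ε)
      in N ℕ.⊔ M , λ i j p q → begin
        ℚ.∣ (seq x i ℚ.- seq y i) ℚ.- (seq x j ℚ.- seq y j) ∣
          ≡⟨ cong ℚ.∣_∣ (regroup (seq x i) (seq y i) (seq x j) (seq y j)) ⟩
        ℚ.∣ (seq x i ℚ.- seq x j) ℚ.- (seq y i ℚ.- seq y j) ∣
          ≤⟨ ℚ.∣p-q∣≤∣p∣+∣q∣ (seq x i ℚ.- seq x j) (seq y i ℚ.- seq y j) ⟩
        ℚ.∣ seq x i ℚ.- seq x j ∣ ℚ.+ ℚ.∣ seq y i ℚ.- seq y j ∣
          ≤⟨ ℚ.+-mono-≤ (cx i j (ℕ.m⊔n≤o⇒m≤o N M p) (ℕ.m⊔n≤o⇒m≤o N M q))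
                        (cy i j (ℕ.m⊔n≤o⇒n≤o N M p) (ℕ.m⊔n≤o⇒n≤o N M q)) ⟩
        ℚ.½ ℚ.* ε ℚ.+ ℚ.½ ℚ.* ε
          ≡⟨ half-+ ε ⟩
        ε ∎
  }
  where
  open +-*-Solver
  regroup : ∀ a b c d → (a ℚ.- b) ℚ.- (c ℚ.- d) ≡ (a ℚ.- c) ℚ.- (b ℚ.- d)
  regroup = solve 4 (λ a b c d → (a :- b) :- (c :- d) := (a :- c) :- (b :- d)) refl

_*_ : ℝ → ℝ → ℝ
x * y = record
  { seq    = λ i → seq x i ℚ.* seq y i
  ; cauchy = prod-cauchy
  }
  where
  open +-*-Solver
  regroup : ∀ a b c d → a ℚ.* b ℚ.- c ℚ.* d ≡ a ℚ.* (b ℚ.- d) ℚ.+ d ℚ.* (a ℚ.- c)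
  regroup = solve 4 (λ a b c d → a :* b :- c :* d := a :* (b :- d) :+ d :* (a :- c)) refl

  prod-cauchy : ∀ ε → 0ℚ ℚ.< ε → ∃[ N ] (∀ i j → N ℕ.≤ i → N ℕ.≤ j →
    ℚ.∣ seq x i ℚ.* seq y i ℚ.- seq x j ℚ.* seq y j ∣ ℚ.≤ ε)
  prod-cauchy ε 0<ε =
    let (Bx , 0<Bx , N₁ , bx) = bounded x
        (By , 0<By , N₂ , by) = bounded y
        (δ , 0<δ , Bδ≡ε)      = divide (Bx ℚ.+ By) ε (ℚ.+-mono-< 0<Bx 0<By) 0<ε
        (N₃ , cx)             = cauchy x δ 0<δ
        (N₄ , cy)             = cauchy y δ 0<δ
        N₁₂ = N₁ ℕ.⊔ N₂
        N₃₄ = N₃ ℕ.⊔ N₄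
    in N₁₂ ℕ.⊔ N₃₄ , λ i j p q →
      close (seq x i) (seq y i) (seq x j) (seq y j) Bx By δ ε 0<Bx 0<By Bδ≡ε
        (bx i (ℕ.m⊔n≤o⇒m≤o N₁ N₂ (ℕ.m⊔n≤o⇒m≤o N₁₂ N₃₄ p)))
        (by j (ℕ.m⊔n≤o⇒n≤o N₁ N₂ (ℕ.m⊔n≤o⇒m≤o N₁₂ N₃₄ q)))
        (cx i j (ℕ.m⊔n≤o⇒m≤o N₃ N₄ (ℕ.m⊔n≤o⇒n≤o N₁₂ N₃₄ p)) (ℕ.m⊔n≤o⇒m≤o N₃ N₄ (ℕ.m⊔n≤o⇒n≤o N₁₂ N₃₄ q)))
        (cy i j (ℕ.m⊔n≤o⇒n≤o N₃ N₄ (ℕ.m⊔n≤o⇒n≤o N₁₂ N₃₄ p)) (ℕ.m⊔n≤o⇒n≤o N₃ N₄ (ℕ.m⊔n≤o⇒n≤o N₁₂ N₃₄ q)))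
    where
    close : ∀ xi yi xj yj Bx By δ ε → 0ℚ ℚ.< Bx → 0ℚ ℚ.< By →
            (Bx ℚ.+ By) ℚ.* δ ≡ ε → ℚ.∣ xi ∣ ℚ.≤ Bx → ℚ.∣ yj ∣ ℚ.≤ By →
            ℚ.∣ xi ℚ.- xj ∣ ℚ.≤ δ → ℚ.∣ yi ℚ.- yj ∣ ℚ.≤ δ →
            ℚ.∣ xi ℚ.* yi ℚ.- xj ℚ.* yj ∣ ℚ.≤ ε
    close xi yi xj yj Bx By δ ε 0<Bx 0<By Bδ≡ε bx by cx cy = begin
      ℚ.∣ xi ℚ.* yi ℚ.- xj ℚ.* yj ∣
        ≡⟨ cong ℚ.∣_∣ (regroup xi yi xj yj) ⟩
      ℚ.∣ xi ℚ.* (yi ℚ.- yj) ℚ.+ yj ℚ.* (xi ℚ.- xj) ∣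
        ≤⟨ ℚ.∣p+q∣≤∣p∣+∣q∣ (xi ℚ.* (yi ℚ.- yj)) (yj ℚ.* (xi ℚ.- xj)) ⟩
      ℚ.∣ xi ℚ.* (yi ℚ.- yj) ∣ ℚ.+ ℚ.∣ yj ℚ.* (xi ℚ.- xj) ∣
        ≡⟨ cong₂ ℚ._+_ (ℚ.∣p*q∣≡∣p∣*∣q∣ xi (yi ℚ.- yj))
                       (ℚ.∣p*q∣≡∣p∣*∣q∣ yj (xi ℚ.- xj)) ⟩
      ℚ.∣ xi ∣ ℚ.* ℚ.∣ yi ℚ.- yj ∣ ℚ.+ ℚ.∣ yj ∣ ℚ.* ℚ.∣ xi ℚ.- xj ∣
        ≤⟨ ℚ.+-mono-≤
             (*-mono (ℚ.0≤∣p∣ (yi ℚ.- yj)) (ℚ.<⇒≤ 0<Bx) bx cy)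
             (*-mono (ℚ.0≤∣p∣ (xi ℚ.- xj)) (ℚ.<⇒≤ 0<By) by cx) ⟩
      Bx ℚ.* δ ℚ.+ By ℚ.* δ
        ≡⟨ sym (ℚ.*-distribʳ-+ δ Bx By) ⟩
      (Bx ℚ.+ By) ℚ.* δ
        ≡⟨ Bδ≡ε ⟩
      ε ∎

------------------------------------------------------------------------
-- Boxes

-- The reward takes the value (value j) with probability (prob j).  As
-- value is injective, an index j is the same information as the reward.
record Box : Set where
  field
    cost            : ℚ
    size            : ℕ
    value           : Fin size → ℚ
    prob            : Fin size → ℚ
    cost-nonneg     : 0ℚ ℚ.≤ cost
    value-nonneg    : ∀ j → 0ℚ ℚ.≤ value j
    value-injective : Injective _≡_ _≡_ value
    prob-pos        : ∀ j → 0ℚ ℚ.< prob j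
    prob-sum        : sum prob ≡ 1ℚ

open Box public

expectedExcess : Box → ℚ → ℚ
expectedExcess b s = sum (λ j → prob b j ℚ.* (0ℚ ℚ.⊔ (value b j ℚ.- s)))

-- E[(V - s)⁺] = c has exactly one solution s when c > 0.  When c = 0 the
-- solutions form a half-line, and its least element is taken.
IsReservationValue : Box → ℚ → Set
IsReservationValue b s =
  expectedExcess b s ≡ cost b × (∀ t → expectedExcess b t ≡ cost b → s ℚ.≤ t)

infix 4 _≻_

_≻_ : Box → Box → Set
b ≻ b′ = ∃[ s ] ∃[ s′ ]
  (IsReservationValue b s × IsReservationValue b′ s′ × s′ ℚ.< s)

-- The indexing of the vector is an order by decreasing reservation value.
Sorted : Vec Box n → Set
Sorted {n} bs = Σ[ σ ∈ (Fin n → ℚ) ]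
  ((∀ i → IsReservationValue (lookup bs i) (σ i)) ×
   (∀ i j → i Fin.≤ j → σ j ℚ.≤ σ i))

------------------------------------------------------------------------
-- The probability space: independent rewards, hence product measure

Realization : Vec Box n → Set
Realization = All (Fin ∘ size)

𝔼 : (bs : Vec Box n) → (Realization bs → ℚ) → ℚ
𝔼 []       f = f []
𝔼 (b ∷ bs) f = sum (λ j → prob b j ℚ.* 𝔼 bs (λ ω → f (j ∷ ω)))

------------------------------------------------------------------------
-- Batches

-- Joint outcomes of the boxes in S.
Observation : Vec Box n → Subset n → Set
Observation []       []          = Unit
Observation (b ∷ bs) (true  ∷ S) = Fin (size b) × Observation bs S
Observation (b ∷ bs) (false ∷ S) = Observation bs S

observe : {bs : Vec Box n} → Realization bs → (S : Subset n) → Observation bs S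
observe []      []          = tt
observe (j ∷ ω) (true  ∷ S) = j , observe ω S
observe (_ ∷ ω) (false ∷ S) = observe ω S

maxReward : (bs : Vec Box n) (S : Subset n) → Observation bs S → ℚ
maxReward []       []          _       = 0ℚ
maxReward (b ∷ bs) (true  ∷ S) (j , o) = value b j ℚ.⊔ maxReward bs S o
maxReward (b ∷ bs) (false ∷ S) o       = maxReward bs S o

itemCosts : Vec Box n → Subset n → ℚ
itemCosts []       []          = 0ℚ
itemCosts (b ∷ bs) (true  ∷ S) = cost b ℚ.+ itemCosts bs S
itemCosts (b ∷ bs) (false ∷ S) = itemCosts bs S

-- U is the set of unopened boxes.
Feasible : ℕ → Subset n → Subset n → Set
Feasible k U S = Nonempty S × S ⊆ U × ∣ S ∣ ℕ.≤ k

------------------------------------------------------------------------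
-- Policies

-- Continuation policies when U is the set of unopened boxes.  A node of
-- the decision tree determines all observations made on the way to it.
data Policy (k : ℕ) (bs : Vec Box n) : Subset n → Set where
  stop      : ∀ {U} → Policy k bs U
  openBatch : ∀ {U} (S : Subset n) → Feasible k U S →
              (Observation bs S → Policy k bs (U ─ S)) → Policy k bs U

module _ {bs : Vec Box n} where

  -- M_π and C_π as random variables; T is the setup cost.
  reward : ∀ {U} → Policy k bs U → Realization bs → ℚ
  reward stop              ω = 0ℚ
  reward (openBatch S _ π) ω =
    maxReward bs S (observe ω S) ℚ.⊔ reward (π (observe ω S)) ω

  totalCost : ∀ {U} → ℚ → Policy k bs U → Realization bs → ℚ
  totalCost T stop              ω = 0ℚ
  totalCost T (openBatch S _ π) ω =
    (T ℚ.+ itemCosts bs S) ℚ.+ totalCost T (π (observe ω S)) ω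

  val : ∀ {U} → ℚ → ℝ → Policy k bs U → ℝ
  val T ƛ π = fromℚ (𝔼 bs (reward π)) - ƛ * fromℚ (𝔼 bs (totalCost T π))

IsOPT₁ : ℚ → ℕ → Vec Box n → ℝ → Set
IsOPT₁ T k bs o =
  (Σ[ π ∈ Policy k bs ⊤ ] val T 1ℝ π ≃ o) ×
  (∀ (π : Policy k bs ⊤) → val T 1ℝ π ≤ o)

-- S is an interval of the index order restricted to U.
IsInterval : Subset n → Subset n → Set
IsInterval U S =
  ∀ {i j l} → i Fin.< j → j Fin.< l → i ∈ S → l ∈ S → j ∈ U → j ∈ S

Consecutive : {bs : Vec Box n} {U : Subset n} → Policy k bs U → Set
Consecutive stop                  = Unit
Consecutive {U = U} (openBatch S _ π) = IsInterval U S × (∀ o → Consecutive (π o))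

------------------------------------------------------------------------
-- Algorithms restricted to consecutive batches

ConsecutiveAlgorithm : ℕ → Set
ConsecutiveAlgorithm k =
  ∀ {n} (bs : Vec Box n) → Sorted bs → (ε : ℝ) → 0ℝ < ε →
  Σ[ π ∈ Policy k bs ⊤ ] Consecutive π

BicriteriaGuarantee : ∀ {k} → ℚ → ℝ → ℝ → ConsecutiveAlgorithm k → Set
BicriteriaGuarantee {k} T α ƛ alg =
  ∀ {n} (bs : Vec Box n) (sorted : Sorted bs) (ε : ℝ) (0<ε : 0ℝ < ε) →
  let (π , _) = alg bs sorted ε 0<ε in
  ∀ o → IsOPT₁ T k bs o → α * o - ε ≤ val T ƛ π

-- All item costs are 0, and every box pays a single positive reward with
-- some probability, so this reward is its reservation value.  A and B have
-- mean ½ + δ; A pays a large reward with probability δ, so that opening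
-- {A, B} together has expected maximum (½ + δ)(2 - δ) > 1.  The k copies of D
-- have rewards between those of A and B, but total mean at most δ.  The
-- only interval containing both A and B initially has k + 2 elements, so a
-- consecutive policy opening both of them pays for at least two batches.
-- Whether a policy opens a box does not depend on the reward in that box,
-- so (Wald) its expected reward is at most the expected sum of the means of
-- the boxes it opens, hence at most ½ + 2δ times the expected number of
-- batches.  An optimal policy exists because a monotone objective can be
-- maximised over functions from a finite set one argument at a time.

module Submission where

open import Defs
open import Data.Fin.Subset using (⊤)
open import Data.Nat.Base as ℕ using (ℕ; suc)
open import Data.Product.Base using (Σ-syntax; ∃-syntax; _×_)
open import Data.Rational.Base using (1ℚ; ½)
open import Data.Vec.Base using (Vec; []; _∷_; _++_; replicate)
open import Relation.Nullary.Negation.Core using (¬_)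

open import Algebra.Bundles using (CommutativeRing)
open import Data.Bool.Base as Bool using (Bool; true; false; _∨_)
open import Data.Fin.Base as Fin using (Fin; zero; suc; toℕ; _↑ʳ_)
import Data.Fin.Properties as Fin
open import Data.Fin.Subset using (Subset; _∈_; _⊆_; _─_; ∣_∣)
import Data.Fin.Subset.Properties as Subset
open import Data.Nat.Base using (zero; z≤n; s≤s)
import Data.Nat.Properties as ℕ
open import Data.Product.Base using (_,_; proj₁; proj₂; curry; uncurry)
open import Data.Rational.Base as ℚ using (ℚ; 0ℚ; positive; nonNegative)
import Data.Rational.Properties as ℚ
open import Data.Rational.Solver using (module +-*-Solver)
open import Data.Sum.Base using (inj₁; inj₂)
open import Data.Vec.Base using (lookup)
import Data.Vec.Functional as F
open import Data.Vec.Properties using (lookup⇒[]=)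
open import Data.Vec.Relation.Unary.All using ([]; _∷_)
open import Function.Base using (_∘_; const)
open import Relation.Binary.PropositionalEquality
  using (_≡_; refl; sym; trans; cong; cong₂; subst; module ≡-Reasoning)
open import Induction.WellFounded using (Acc; acc)
open import Data.Nat.Induction using (<-wellFounded)
open import Relation.Nullary.Decidable.Core using (Dec; yes; no; _×-dec_; toWitness)
open import Relation.Nullary.Negation.Core using (contradiction)

open import Algebra.Properties.CommutativeMonoid.Sum ℚ.+-0-commutativeMonoid
  using (sum; sum-cong-≗; ∑-distrib-+)
open import Algebra.Properties.Semiring.Sum (CommutativeRing.semiring ℚ.+-*-commutativeRing)
  using (*-distribˡ-sum; *-distribʳ-sum)
open import Algebra.Properties.CommutativeMonoid.Mult ℚ.+-0-commutativeMonoid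
  using () renaming (_×_ to _⋆_)

private
  variable
    n k : ℕ
    bs : Vec Box n

-- Expectation

sum-mono : ∀ {m} {f g : Fin m → ℚ} → (∀ j → f j ℚ.≤ g j) → sum f ℚ.≤ sum g
sum-mono {zero}  f≤g = ℚ.≤-refl
sum-mono {suc m} f≤g = ℚ.+-mono-≤ (f≤g zero) (sum-mono (f≤g ∘ suc))

*-monoˡ-prob : (b : Box) (j : Fin (size b)) {x y : ℚ} → x ℚ.≤ y →
               prob b j ℚ.* x ℚ.≤ prob b j ℚ.* y
*-monoˡ-prob b j = ℚ.*-monoˡ-≤-nonNeg (prob b j) {{nonNegative (ℚ.<⇒≤ (prob-pos b j))}}

𝔼-mono : (bs : Vec Box n) {f g : Realization bs → ℚ} →
         (∀ ω → f ω ℚ.≤ g ω) → 𝔼 bs f ℚ.≤ 𝔼 bs g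
𝔼-mono []       f≤g = f≤g []
𝔼-mono (b ∷ bs) f≤g = sum-mono λ j → *-monoˡ-prob b j (𝔼-mono bs λ ω → f≤g (j ∷ ω))

𝔼-cong : (bs : Vec Box n) {f g : Realization bs → ℚ} →
         (∀ ω → f ω ≡ g ω) → 𝔼 bs f ≡ 𝔼 bs g
𝔼-cong []       f≗g = f≗g []
𝔼-cong (b ∷ bs) f≗g =
  sum-cong-≗ λ j → cong (prob b j ℚ.*_) (𝔼-cong bs λ ω → f≗g (j ∷ ω))

𝔼-+ : (bs : Vec Box n) (f g : Realization bs → ℚ) →
      𝔼 bs (λ ω → f ω ℚ.+ g ω) ≡ 𝔼 bs f ℚ.+ 𝔼 bs g
𝔼-+ []       f g = refl
𝔼-+ (b ∷ bs) f g = trans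
  (sum-cong-≗ λ j → trans
    (cong (prob b j ℚ.*_) (𝔼-+ bs (λ ω → f (j ∷ ω)) (λ ω → g (j ∷ ω))))
    (ℚ.*-distribˡ-+ (prob b j) (𝔼 bs (λ ω → f (j ∷ ω))) (𝔼 bs (λ ω → g (j ∷ ω)))))
  (∑-distrib-+ (λ j → prob b j ℚ.* 𝔼 bs (λ ω → f (j ∷ ω)))
               (λ j → prob b j ℚ.* 𝔼 bs (λ ω → g (j ∷ ω))))

𝔼-*ʳ : (bs : Vec Box n) (f : Realization bs → ℚ) (c : ℚ) →
       𝔼 bs (λ ω → f ω ℚ.* c) ≡ 𝔼 bs f ℚ.* c
𝔼-*ʳ []       f c = refl
𝔼-*ʳ (b ∷ bs) f c = trans
  (sum-cong-≗ λ j → trans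
    (cong (prob b j ℚ.*_) (𝔼-*ʳ bs (λ ω → f (j ∷ ω)) c))
    (sym (ℚ.*-assoc (prob b j) (𝔼 bs (λ ω → f (j ∷ ω))) c)))
  (sym (*-distribʳ-sum c (λ j → prob b j ℚ.* 𝔼 bs (λ ω → f (j ∷ ω)))))

sum-prob-* : (b : Box) (c : ℚ) → sum (λ j → prob b j ℚ.* c) ≡ c
sum-prob-* b c = trans (sym (*-distribʳ-sum c (prob b)))
  (trans (cong (ℚ._* c) (prob-sum b)) (ℚ.*-identityˡ c))

𝔼-const : (bs : Vec Box n) (c : ℚ) → 𝔼 bs (const c) ≡ c
𝔼-const []       c = refl
𝔼-const (b ∷ bs) c =
  trans (sum-cong-≗ λ j → cong (prob b j ℚ.*_) (𝔼-const bs c)) (sum-prob-* b c)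

mean : Box → ℚ
mean b = sum (λ j → prob b j ℚ.* value b j)

mean-nonneg : (b : Box) → 0ℚ ℚ.≤ mean b
mean-nonneg b = subst (ℚ._≤ mean b) (sum-prob-* b 0ℚ)
  (sum-mono λ j → *-monoˡ-prob b j (value-nonneg b j))

-- Wald's identity for sets of boxes

indicator : Bool → ℚ
indicator true  = 1ℚ
indicator false = 0ℚ

indicator-nonneg : ∀ s → 0ℚ ℚ.≤ indicator s
indicator-nonneg true  = ℚ.<⇒≤ (ℚ.positive⁻¹ 1ℚ)
indicator-nonneg false = ℚ.≤-refl

indicator≤1 : ∀ s → indicator s ℚ.≤ 1ℚ
indicator≤1 true  = ℚ.≤-refl
indicator≤1 false = ℚ.<⇒≤ (ℚ.positive⁻¹ 1ℚ)

indicator-mono : ∀ {s t} → s Bool.≤ t → indicator s ℚ.≤ indicator t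
indicator-mono Bool.f≤t = ℚ.<⇒≤ (ℚ.positive⁻¹ 1ℚ)
indicator-mono Bool.b≤b = ℚ.≤-refl

rewardSum : (bs : Vec Box n) → (Fin n → Bool) → Realization bs → ℚ
rewardSum []       O []      = 0ℚ
rewardSum (b ∷ bs) O (j ∷ ω) = indicator (O zero) ℚ.* value b j ℚ.+ rewardSum bs (O ∘ suc) ω

meanSum : (bs : Vec Box n) → (Fin n → Bool) → ℚ
meanSum []       O = 0ℚ
meanSum (b ∷ bs) O = indicator (O zero) ℚ.* mean b ℚ.+ meanSum bs (O ∘ suc)

rewardSum-mono : (bs : Vec Box n) {O P : Fin n → Bool} (ω : Realization bs) →
                 (∀ i → O i Bool.≤ P i) → rewardSum bs O ω ℚ.≤ rewardSum bs P ω
rewardSum-mono []       []      O≤P = ℚ.≤-refl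
rewardSum-mono (b ∷ bs) (j ∷ ω) O≤P = ℚ.+-mono-≤
  (ℚ.*-monoʳ-≤-nonNeg (value b j) {{nonNegative (value-nonneg b j)}}
    (indicator-mono (O≤P zero)))
  (rewardSum-mono bs ω (O≤P ∘ suc))

rewardSum-⊥ : (bs : Vec Box n) (ω : Realization bs) → rewardSum bs (const false) ω ≡ 0ℚ
rewardSum-⊥ []       []      = refl
rewardSum-⊥ (b ∷ bs) (j ∷ ω) =
  cong₂ ℚ._+_ (ℚ.*-zeroˡ (value b j)) (rewardSum-⊥ bs ω)

rewardSum-nonneg : (bs : Vec Box n) (O : Fin n → Bool) (ω : Realization bs) →
                   0ℚ ℚ.≤ rewardSum bs O ω
rewardSum-nonneg bs O ω = subst (ℚ._≤ rewardSum bs O ω) (rewardSum-⊥ bs ω)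
  (rewardSum-mono bs ω λ i → false≤ (O i))
  where
  false≤ : ∀ s → false Bool.≤ s
  false≤ true  = Bool.f≤t
  false≤ false = Bool.b≤b

-- An inductive form, so that it can be taken apart in step with the recursion of `𝔼` over the
-- boxes.
data AgreeOff : {bs : Vec Box n} → Fin n → Realization bs → Realization bs → Set where
  here  : ∀ {b} {bs : Vec Box n} {j j′ : Fin (size b)} {ω : Realization bs} →
          AgreeOff {bs = b ∷ bs} zero (j ∷ ω) (j′ ∷ ω)
  there : ∀ {b} {bs : Vec Box n} {i} {j : Fin (size b)} {ω ω′ : Realization bs} →
          AgreeOff i ω ω′ → AgreeOff {bs = b ∷ bs} (suc i) (j ∷ ω) (j ∷ ω′)

-- Membership of box `i` may depend on every reward except its own. This is the form of adaptedness
-- on which Wald's identity rests here.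
NonAnticipating : (bs : Vec Box n) → (Realization bs → Fin n → Bool) → Set
NonAnticipating bs O = ∀ {i ω ω′} → AgreeOff i ω ω′ → O ω i ≡ O ω′ i

-- The common value of `h` leaves the sum, and the total mass 1 brings it back in front of the mean
-- of `v`. In the application `h` is the conditional probability that a box is opened, given its own
-- outcome.
sum-decouple : ∀ {m} (p v h : Fin m → ℚ) → (∀ i j → h i ≡ h j) → sum p ≡ 1ℚ →
               sum (λ j → p j ℚ.* (h j ℚ.* v j)) ≡
               sum (λ j → p j ℚ.* (h j ℚ.* sum (λ i → p i ℚ.* v i)))
sum-decouple {zero}  p v h h-const p≡1 = refl
sum-decouple {suc m} p v h h-const p≡1 = begin
  sum (λ j → p j ℚ.* (h j ℚ.* v j))
    ≡⟨ sum-cong-≗ (λ j → trans (cong (λ c → p j ℚ.* (c ℚ.* v j)) (h-const j zero))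
                               (swap (p j) c (v j))) ⟩
  sum (λ j → c ℚ.* (p j ℚ.* v j))
    ≡⟨ sym (*-distribˡ-sum c (λ j → p j ℚ.* v j)) ⟩
  c ℚ.* e
    ≡⟨ sym (ℚ.*-identityˡ _) ⟩
  1ℚ ℚ.* (c ℚ.* e)
    ≡⟨ cong (ℚ._* (c ℚ.* e)) (sym p≡1) ⟩
  sum p ℚ.* (c ℚ.* e)
    ≡⟨ *-distribʳ-sum (c ℚ.* e) p ⟩
  sum (λ j → p j ℚ.* (c ℚ.* e))
    ≡⟨ sum-cong-≗ (λ j → cong (λ c → p j ℚ.* (c ℚ.* e)) (h-const zero j)) ⟩
  sum (λ j → p j ℚ.* (h j ℚ.* e)) ∎
  where
  open ≡-Reasoning
  open +-*-Solver
  c = h zero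
  e = sum (λ i → p i ℚ.* v i)
  swap : ∀ x y z → x ℚ.* (y ℚ.* z) ≡ y ℚ.* (x ℚ.* z)
  swap = solve 3 (λ x y z → x :* (y :* z) := y :* (x :* z)) refl

-- Condition on the outcome `j` of the first box. The probability `H j` that this box belongs to the
-- set does not vary with `j`, so its reward can be replaced by its mean; the other boxes follow by
-- induction with `j` fixed.
𝔼-rewardSum : (bs : Vec Box n) (O : Realization bs → Fin n → Bool) → NonAnticipating bs O →
              𝔼 bs (λ ω → rewardSum bs (O ω) ω) ≡ 𝔼 bs (λ ω → meanSum bs (O ω))
𝔼-rewardSum []       O na = refl
𝔼-rewardSum (b ∷ bs) O na = begin
  sum (λ j → prob b j ℚ.* 𝔼 bs (λ ω → hit j ω ℚ.* value b j ℚ.+ rewardSum bs (rest j ω) ω))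
    ≡⟨ sum-cong-≗ (λ j → trans (split j (value b j) (λ ω → rewardSum bs (rest j ω) ω))
         (cong (λ x → prob b j ℚ.* (H j ℚ.* value b j) ℚ.+ prob b j ℚ.* x)
           (𝔼-rewardSum bs (rest j) (λ a → na (there a))))) ⟩
  sum (λ j → prob b j ℚ.* (H j ℚ.* value b j) ℚ.+ prob b j ℚ.* R j)
    ≡⟨ ∑-distrib-+ (λ j → prob b j ℚ.* (H j ℚ.* value b j)) (λ j → prob b j ℚ.* R j) ⟩
  sum (λ j → prob b j ℚ.* (H j ℚ.* value b j)) ℚ.+ sum (λ j → prob b j ℚ.* R j)
    ≡⟨ cong (ℚ._+ sum (λ j → prob b j ℚ.* R j))
         (sum-decouple (prob b) (value b) H
           (λ i j → 𝔼-cong bs (λ ω → cong indicator (na here))) (prob-sum b)) ⟩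
  sum (λ j → prob b j ℚ.* (H j ℚ.* mean b)) ℚ.+ sum (λ j → prob b j ℚ.* R j)
    ≡⟨ sym (∑-distrib-+ (λ j → prob b j ℚ.* (H j ℚ.* mean b)) (λ j → prob b j ℚ.* R j)) ⟩
  sum (λ j → prob b j ℚ.* (H j ℚ.* mean b) ℚ.+ prob b j ℚ.* R j)
    ≡⟨ sum-cong-≗ (λ j → sym (split j (mean b) (λ ω → meanSum bs (rest j ω)))) ⟩
  sum (λ j → prob b j ℚ.* 𝔼 bs (λ ω → hit j ω ℚ.* mean b ℚ.+ meanSum bs (rest j ω))) ∎
  where
  open ≡-Reasoning
  hit : Fin (size b) → Realization bs → ℚ
  hit j ω = indicator (O (j ∷ ω) zero)
  rest : Fin (size b) → Realization bs → Fin _ → Bool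
  rest j ω = O (j ∷ ω) ∘ suc
  H R : Fin (size b) → ℚ
  H j = 𝔼 bs (hit j)
  R j = 𝔼 bs (λ ω → meanSum bs (rest j ω))
  split : ∀ j c (g : Realization bs → ℚ) →
          prob b j ℚ.* 𝔼 bs (λ ω → hit j ω ℚ.* c ℚ.+ g ω) ≡
          prob b j ℚ.* (H j ℚ.* c) ℚ.+ prob b j ℚ.* 𝔼 bs g
  split j c g = trans
    (cong (prob b j ℚ.*_) (trans (𝔼-+ bs (λ ω → hit j ω ℚ.* c) g)
                                 (cong (ℚ._+ 𝔼 bs g) (𝔼-*ʳ bs (hit j) c))))
    (ℚ.*-distribˡ-+ (prob b j) (H j ℚ.* c) (𝔼 bs g))

-- Sets opened by policies

opened : {bs : Vec Box n} → ∀ {U} → Policy k bs U → Realization bs → Fin n → Bool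
opened stop              ω i = false
opened (openBatch S _ π) ω i = lookup S i ∨ opened (π (observe ω S)) ω i

observe-agreeOff : {bs : Vec Box n} → ∀ {i} {ω ω′ : Realization bs} → AgreeOff i ω ω′ → (S : Subset n) →
                   lookup S i ≡ false → observe ω S ≡ observe ω′ S
observe-agreeOff here      (false ∷ S) refl = refl
observe-agreeOff (there a) (true  ∷ S) i∉S  = cong (_ ,_) (observe-agreeOff a S i∉S)
observe-agreeOff (there a) (false ∷ S) i∉S  = observe-agreeOff a S i∉S

-- If the first batch contains box `i`, both answers are `true`. Otherwise the batch shows the same
-- outcomes in both realizations, so the policy continues in the same way.
opened-nonAnticipating : ∀ {U} (π : Policy k bs U) → NonAnticipating bs (opened π)
opened-nonAnticipating stop              a = refl
opened-nonAnticipating (openBatch S _ π) {i} {ω} {ω′} a with lookup S i in i∈S?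
... | true  = refl
... | false = trans (opened-nonAnticipating (π (observe ω S)) a)
                    (cong (λ o → opened (π o) ω′ i) (observe-agreeOff a S i∈S?))

maxReward≤rewardSum : (bs : Vec Box n) (S : Subset n) (ω : Realization bs) →
                      maxReward bs S (observe ω S) ℚ.≤ rewardSum bs (lookup S) ω
maxReward≤rewardSum []       []          []      = ℚ.≤-refl
maxReward≤rewardSum (b ∷ bs) (true  ∷ S) (j ∷ ω) = ℚ.⊔-lub
  (begin
    value b j                    ≡⟨ ℚ.+-identityʳ _ ⟨
    value b j ℚ.+ 0ℚ             ≤⟨ ℚ.+-mono-≤ (ℚ.≤-reflexive (sym (ℚ.*-identityˡ (value b j))))
                                               (rewardSum-nonneg bs (lookup S) ω) ⟩
    1ℚ ℚ.* value b j ℚ.+ rewardSum bs (lookup S) ω ∎)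
  (begin
    maxReward bs S (observe ω S)              ≡⟨ ℚ.+-identityˡ _ ⟨
    0ℚ ℚ.+ maxReward bs S (observe ω S)       ≤⟨ ℚ.+-mono-≤
      (ℚ.≤-trans (value-nonneg b j) (ℚ.≤-reflexive (sym (ℚ.*-identityˡ _))))
      (maxReward≤rewardSum bs S ω) ⟩
    1ℚ ℚ.* value b j ℚ.+ rewardSum bs (lookup S) ω ∎)
  where open ℚ.≤-Reasoning hiding (stop)
maxReward≤rewardSum (b ∷ bs) (false ∷ S) (j ∷ ω) = ℚ.≤-trans
  (maxReward≤rewardSum bs S ω)
  (ℚ.≤-reflexive (sym (trans (cong (ℚ._+ rewardSum bs (lookup S) ω) (ℚ.*-zeroˡ (value b j)))
                             (ℚ.+-identityˡ _))))

≤-∨ˡ : ∀ s t → s Bool.≤ s ∨ t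
≤-∨ˡ true  t     = Bool.b≤b
≤-∨ˡ false true  = Bool.f≤t
≤-∨ˡ false false = Bool.b≤b

≤-∨ʳ : ∀ s t → t Bool.≤ s ∨ t
≤-∨ʳ true  true  = Bool.b≤b
≤-∨ʳ true  false = Bool.f≤t
≤-∨ʳ false t     = Bool.b≤b

-- Rewards are non-negative, so a maximum is at most a sum; the batch and the continuation are each
-- compared with the sum over the union of what they open.
reward≤rewardSum : ∀ {U} (π : Policy k bs U) (ω : Realization bs) →
                   reward π ω ℚ.≤ rewardSum bs (opened π ω) ω
reward≤rewardSum {bs = bs} stop              ω = rewardSum-nonneg bs _ ω
reward≤rewardSum {bs = bs} (openBatch S _ π) ω = ℚ.⊔-lub
  (ℚ.≤-trans (maxReward≤rewardSum bs S ω)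
    (rewardSum-mono bs ω λ i → ≤-∨ˡ (lookup S i) _))
  (ℚ.≤-trans (reward≤rewardSum (π (observe ω S)) ω)
    (rewardSum-mono bs ω λ i → ≤-∨ʳ (lookup S i) _))

𝔼reward≤𝔼meanSum : ∀ {U} (π : Policy k bs U) →
                   𝔼 bs (reward π) ℚ.≤ 𝔼 bs (λ ω → meanSum bs (opened π ω))
𝔼reward≤𝔼meanSum {bs = bs} π = ℚ.≤-trans (𝔼-mono bs (reward≤rewardSum π))
  (ℚ.≤-reflexive (𝔼-rewardSum bs (opened π) (opened-nonAnticipating π)))

-- Lower bounds for the cost of a policy

itemCosts-nonneg : (bs : Vec Box n) (S : Subset n) → 0ℚ ℚ.≤ itemCosts bs S
itemCosts-nonneg []       []          = ℚ.≤-refl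
itemCosts-nonneg (b ∷ bs) (true  ∷ S) = ℚ.+-mono-≤ (cost-nonneg b) (itemCosts-nonneg bs S)
itemCosts-nonneg (b ∷ bs) (false ∷ S) = itemCosts-nonneg bs S

-- Through this inequality the total cost serves as an upper bound for the number of batches.
1+totalCost≤ : {bs : Vec Box n} → ∀ {U} (S : Subset n) (f : Feasible k U S)
               (π : Observation bs S → Policy k bs (U ─ S)) (ω : Realization bs) →
               1ℚ ℚ.+ totalCost 1ℚ (π (observe ω S)) ω ℚ.≤ totalCost 1ℚ (openBatch S f π) ω
1+totalCost≤ {bs = bs} S f π ω = ℚ.+-monoˡ-≤ _
  (subst (ℚ._≤ 1ℚ ℚ.+ itemCosts bs S) (ℚ.+-identityʳ 1ℚ)
    (ℚ.+-monoʳ-≤ 1ℚ (itemCosts-nonneg bs S)))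

totalCost-nonneg : ∀ {U} (π : Policy k bs U) ω → 0ℚ ℚ.≤ totalCost 1ℚ π ω
totalCost-nonneg stop              ω = ℚ.≤-refl
totalCost-nonneg (openBatch S f π) ω = ℚ.≤-trans
  (ℚ.+-mono-≤ (ℚ.<⇒≤ (ℚ.positive⁻¹ 1ℚ)) (totalCost-nonneg (π (observe ω S)) ω))
  (1+totalCost≤ S f π ω)

𝔼totalCost-nonneg : ∀ {U} (π : Policy k bs U) → 0ℚ ℚ.≤ 𝔼 bs (totalCost 1ℚ π)
𝔼totalCost-nonneg {bs = bs} π = subst (ℚ._≤ 𝔼 bs (totalCost 1ℚ π)) (𝔼-const bs 0ℚ)
  (𝔼-mono bs (totalCost-nonneg π))

1≤totalCost-openBatch : {bs : Vec Box n} → ∀ {U} (S : Subset n) (f : Feasible k U S)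
                        (π : Observation bs S → Policy k bs (U ─ S)) (ω : Realization bs) →
                        1ℚ ℚ.≤ totalCost 1ℚ (openBatch S f π) ω
1≤totalCost-openBatch S f π ω = ℚ.≤-trans
  (subst (ℚ._≤ 1ℚ ℚ.+ totalCost 1ℚ (π (observe ω S)) ω) (ℚ.+-identityʳ 1ℚ)
    (ℚ.+-monoʳ-≤ 1ℚ (totalCost-nonneg (π (observe ω S)) ω)))
  (1+totalCost≤ S f π ω)

opened≤totalCost : ∀ {U} (π : Policy k bs U) ω i →
                   indicator (opened π ω i) ℚ.≤ totalCost 1ℚ π ω
opened≤totalCost stop              ω i = ℚ.≤-refl
opened≤totalCost (openBatch S f π) ω i =
  ℚ.≤-trans (indicator≤1 (opened (openBatch S f π) ω i)) (1≤totalCost-openBatch S f π ω)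

-- Consecutive policies

-- As `l` is the last index, every box other than the two ends lies strictly between them, and
-- before the first batch all boxes are unopened.
interval⊇⊤ : {S : Subset (suc n)} {l : Fin n} → (∀ i → i Fin.≤ l) → IsInterval ⊤ S →
             zero ∈ S → suc l ∈ S → ⊤ ⊆ S
interval⊇⊤ l-max int 0∈S l∈S {zero}  _ = 0∈S
interval⊇⊤ {l = l} l-max int 0∈S l∈S {suc i} _ with ℕ.m≤n⇒m<n∨m≡n (l-max i)
... | inj₁ i<l = int (s≤s z≤n) (s≤s i<l) 0∈S l∈S Subset.∈⊤
... | inj₂ i≡l = subst (λ j → suc j ∈ _) (sym (Fin.toℕ-injective i≡l)) l∈S

-- The first batch cannot contain both ends, so the end it misses is paid
-- for by a later batch.
consecutive-ends≤totalCost :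
  {bs : Vec Box (suc n)} {l : Fin n} → (∀ i → i Fin.≤ l) → k ℕ.≤ n →
  (π : Policy k bs ⊤) → Consecutive π → ∀ ω →
  indicator (opened π ω zero) ℚ.+ indicator (opened π ω (suc l)) ℚ.≤ totalCost 1ℚ π ω
consecutive-ends≤totalCost l-max k≤n stop _ ω = ℚ.≤-refl
consecutive-ends≤totalCost {n = n} {l = l} l-max k≤n (openBatch S f@(_ , _ , ∣S∣≤k) π) (int , _) ω
  with lookup S zero in 0∈S? | lookup S (suc l) in l∈S?
-- The batch would have `suc n` elements, while `k ≤ n`.
... | true | true = contradiction
  (ℕ.≤-trans (subst (ℕ._≤ ∣ S ∣) (Subset.∣⊤∣≡n (suc n)) (Subset.p⊆q⇒∣p∣≤∣q∣
    (interval⊇⊤ l-max int (lookup⇒[]= zero S 0∈S?) (lookup⇒[]= (suc l) S l∈S?))))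
    (ℕ.≤-trans ∣S∣≤k k≤n))
  (ℕ.<-irrefl refl)
-- This batch pays for the last box, whatever `s` is, and the continuation pays for the first.
... | false | s = ℚ.≤-trans
  (subst (ℚ._≤ _) (ℚ.+-comm (indicator (s ∨ opened rest ω (suc l))) (indicator (opened rest ω zero)))
    (ℚ.+-mono-≤ (indicator≤1 (s ∨ opened rest ω (suc l))) (opened≤totalCost rest ω zero)))
  (1+totalCost≤ S f π ω)
  where rest = π (observe ω S)
... | true | false = ℚ.≤-trans
  (ℚ.+-monoʳ-≤ 1ℚ (opened≤totalCost (π (observe ω S)) ω (suc l)))
  (1+totalCost≤ S f π ω)

-- Existence of optimal policies

-- Monotonicity of the objective replaces function extensionality: candidates that agree pointwise
-- need not be equal, but they lie below each other and so have the same objective.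
Searchable : (A : Set) → (A → A → Set) → Set
Searchable A _≲_ = (G : A → ℚ) → (∀ {x y} → x ≲ y → G x ℚ.≤ G y) →
                   Σ[ a ∈ A ] (∀ b → G b ℚ.≤ G a)

module _ {A : Set} {_≲_ : A → A → Set} (≲-refl : ∀ {x} → x ≲ x) (search : Searchable A _≲_) where

  -- Choose an optimal tail for every head, then an optimal head.
  searchable-Fin→ : ∀ m → Searchable (Fin m → A) (λ f g → ∀ j → f j ≲ g j)
  searchable-Fin→ zero    G G-mono = (λ ()) , λ f → G-mono λ ()
  searchable-Fin→ (suc m) G G-mono =
      x* F.∷ tail* x*
    , λ f → ℚ.≤-trans (G-mono {f} {f zero F.∷ (f ∘ suc)} λ { zero → ≲-refl ; (suc j) → ≲-refl })
              (ℚ.≤-trans (tail*-max (f zero) (f ∘ suc)) (x*-max (f zero)))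
    where
    tails : ∀ x → Σ[ f ∈ (Fin m → A) ] (∀ g → G (x F.∷ g) ℚ.≤ G (x F.∷ f))
    tails x = searchable-Fin→ m (λ f → G (x F.∷ f))
      λ f≲g → G-mono λ { zero → ≲-refl ; (suc j) → f≲g j }
    tail* : A → Fin m → A
    tail* x = proj₁ (tails x)
    tail*-max : ∀ x g → G (x F.∷ g) ℚ.≤ G (x F.∷ tail* x)
    tail*-max x = proj₂ (tails x)
    heads : Σ[ x ∈ A ] (∀ y → G (y F.∷ tail* y) ℚ.≤ G (x F.∷ tail* x))
    -- The optimum over tails is monotone in the head: keep the tail chosen for `x` while raising
    -- the head to `y`, then pass to the tail chosen for `y`.
    heads = search (λ x → G (x F.∷ tail* x)) λ {x} {y} x≲y → ℚ.≤-trans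
      (G-mono λ { zero → x≲y ; (suc j) → ≲-refl }) (tail*-max y (tail* x))
    x* = proj₁ heads
    x*-max = proj₂ heads

searchable-Observation→ :
  {A : Set} {_≲_ : A → A → Set} → (∀ {x} → x ≲ x) → Searchable A _≲_ →
  (bs : Vec Box n) (S : Subset n) →
  Searchable (Observation bs S → A) (λ f g → ∀ o → f o ≲ g o)
searchable-Observation→ ≲-refl search []       []          G G-mono =
  let (a , a-max) = search (G ∘ const) (λ x≲y → G-mono λ _ → x≲y)
  in const a , λ f → a-max (f _)
searchable-Observation→ ≲-refl search (b ∷ bs) (true ∷ S)  G G-mono =
  let (f , f-max) = searchable-Fin→ (λ _ → ≲-refl)
        (searchable-Observation→ ≲-refl search bs S) (size b)
        (G ∘ uncurry) (λ f≲g → G-mono λ (j , o) → f≲g j o)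
  in uncurry f , λ g → f-max (curry g)
searchable-Observation→ ≲-refl search (b ∷ bs) (false ∷ S) =
  searchable-Observation→ ≲-refl search bs S

subset-argmax : (G : Subset n → ℚ) → Σ[ S ∈ Subset n ] (∀ S′ → G S′ ℚ.≤ G S)
subset-argmax {zero}  G = [] , λ { [] → ℚ.≤-refl }
subset-argmax {suc n} G with subset-argmax (G ∘ (true ∷_)) | subset-argmax (G ∘ (false ∷_))
... | S , S-max | S′ , S′-max with ℚ.≤-total (G (true ∷ S)) (G (false ∷ S′))
...   | inj₁ ≤′ = false ∷ S′ , λ
  { (true ∷ P) → ℚ.≤-trans (S-max P) ≤′ ; (false ∷ P) → S′-max P }
...   | inj₂ ≥′ = true ∷ S , λ
  { (true ∷ P) → S-max P ; (false ∷ P) → ℚ.≤-trans (S′-max P) ≥′ }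

module _ {k n : ℕ} {bs : Vec Box n} where

  infix 4 _≲_

  -- Domination on every realization, rather than in expectation, survives when the continuations
  -- are placed behind a common batch, and it still makes `value₁` monotone.
  record _≲_ {U} (π ρ : Policy k bs U) : Set where
    constructor dominated
    field
      reward≤    : ∀ ω → reward π ω ℚ.≤ reward ρ ω
      totalCost≥ : ∀ ω → totalCost 1ℚ ρ ω ℚ.≤ totalCost 1ℚ π ω

  open _≲_

  ≲-refl : ∀ {U} {π : Policy k bs U} → π ≲ π
  ≲-refl = dominated (λ _ → ℚ.≤-refl) (λ _ → ℚ.≤-refl)

  -- The two feasibility proofs may differ, since neither rewards nor costs inspect them.
  openBatch-mono : ∀ {U} {S : Subset n} {f f′ : Feasible k U S}
                   {π ρ : Observation bs S → Policy k bs (U ─ S)} →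
                   (∀ o → π o ≲ ρ o) → openBatch S f π ≲ openBatch S f′ ρ
  openBatch-mono {S = S} π≲ρ = dominated
    (λ ω → ℚ.⊔-monoʳ-≤ (maxReward bs S (observe ω S)) (reward≤ (π≲ρ (observe ω S)) ω))
    (λ ω → ℚ.+-monoʳ-≤ (1ℚ ℚ.+ itemCosts bs S) (totalCost≥ (π≲ρ (observe ω S)) ω))

  feasible? : (U S : Subset n) → Dec (Feasible k U S)
  feasible? U S = Subset.nonempty? S ×-dec S Subset.⊆? U ×-dec ∣ S ∣ ℕ.≤? k

  feasible⇒∣U─S∣<∣U∣ : {U S : Subset n} → Feasible k U S → ∣ U ─ S ∣ ℕ.< ∣ U ∣
  feasible⇒∣U─S∣<∣U∣ {U} {S} ((i , i∈S) , S⊆U , _) =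
    Subset.p∩q≢∅⇒∣p─q∣<∣p∣ U S (i , Subset.x∈p∩q⁺ (S⊆U i∈S , i∈S))

  -- After a first batch `S`, a policy is a function from finitely many observations to policies on
  -- the smaller set `U ─ S`. An optimal continuation is found for each `S`, then an optimal `S`,
  -- and the result is compared with `stop`.
  searchable-Policy : ∀ U → Acc ℕ._<_ ∣ U ∣ → Searchable (Policy k bs U) _≲_
  searchable-Policy U (acc rs) G G-mono =
    proj₁ best , λ
      { stop              → proj₁ (proj₂ best)
      ; (openBatch S f π) → ℚ.≤-trans
          (proj₂ (batch S (feasible? U S)) f π) (proj₂ (proj₂ best) S)
      }
    where
    batch : ∀ S → Dec (Feasible k U S) →
            Σ[ ρ ∈ Policy k bs U ] (∀ f π → G (openBatch S f π) ℚ.≤ G ρ)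
    -- `stop` is a default value here: no policy begins with an infeasible batch.
    batch S (no ¬f) = stop , λ f → contradiction f ¬f
    batch S (yes f) =
      let (ρ , ρ-max) = searchable-Observation→ ≲-refl
            (searchable-Policy (U ─ S) (rs (feasible⇒∣U─S∣<∣U∣ f))) bs S
            (G ∘ openBatch S f) (G-mono ∘ openBatch-mono)
      in openBatch S f ρ
       , λ f′ π → ℚ.≤-trans (G-mono (openBatch-mono λ _ → ≲-refl)) (ρ-max π)
    candidate : Subset n → Policy k bs U
    candidate S = proj₁ (batch S (feasible? U S))
    best : Σ[ ρ ∈ Policy k bs U ] (G stop ℚ.≤ G ρ × (∀ S → G (candidate S) ℚ.≤ G ρ))
    best with subset-argmax (G ∘ candidate)
    ... | S , S-max with ℚ.≤-total (G stop) (G (candidate S))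
    ...   | inj₁ stop≤ = candidate S , stop≤ , S-max
    ...   | inj₂ ≤stop = stop , ℚ.≤-refl , λ P → ℚ.≤-trans (S-max P) ≤stop

  -- The rational form of `val 1ℚ 1ℝ`, so that the search takes place in `ℚ`, where the order is
  -- total.
  value₁ : ∀ {U} → Policy k bs U → ℚ
  value₁ π = 𝔼 bs (reward π) ℚ.- 𝔼 bs (totalCost 1ℚ π)

  optimalPolicy : Σ[ π ∈ Policy k bs ⊤ ] (∀ ρ → value₁ ρ ℚ.≤ value₁ π)
  optimalPolicy = searchable-Policy ⊤ (<-wellFounded ∣ ⊤ {n} ∣) value₁
    λ π≲ρ → ℚ.+-mono-≤ (𝔼-mono bs (reward≤ π≲ρ)) (ℚ.neg-antimono-≤ (𝔼-mono bs (totalCost≥ π≲ρ)))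

-- Coin boxes

p+q≡r⇒p<r : ∀ {p q r} → 0ℚ ℚ.< q → p ℚ.+ q ≡ r → p ℚ.< r
p+q≡r⇒p<r {p} 0<q eq =
  subst (p ℚ.<_) eq (subst (ℚ._< p ℚ.+ _) (ℚ.+-identityʳ p) (ℚ.+-monoʳ-< p 0<q))

*-pos : ∀ {p q} → 0ℚ ℚ.< p → 0ℚ ℚ.< q → 0ℚ ℚ.< p ℚ.* q
*-pos {p} {q} 0<p 0<q =
  ℚ.positive⁻¹ (p ℚ.* q) {{ℚ.pos*pos⇒pos p {{positive 0<p}} q {{positive 0<q}}}}

p<q⇒0<q-p : ∀ {p q} → p ℚ.< q → 0ℚ ℚ.< q ℚ.- p
p<q⇒0<q-p {p} {q} p<q = subst (ℚ._< q ℚ.- p) (ℚ.+-inverseʳ p) (ℚ.+-monoˡ-< (ℚ.- p) p<q)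

module _ (v p : ℚ) (0<v : 0ℚ ℚ.< v) (0<p : 0ℚ ℚ.< p) (p<1 : p ℚ.< 1ℚ) where

  coin : Box
  coin .cost = 0ℚ
  coin .size = 2
  coin .value zero    = v
  coin .value (suc _) = 0ℚ
  coin .prob zero    = p
  coin .prob (suc _) = 1ℚ ℚ.- p
  coin .cost-nonneg = ℚ.≤-refl
  coin .value-nonneg zero    = ℚ.<⇒≤ 0<v
  coin .value-nonneg (suc _) = ℚ.≤-refl
  coin .value-injective {zero}     {zero}     _   = refl
  coin .value-injective {zero}     {suc zero} v≡0 = contradiction (sym v≡0) (ℚ.<⇒≢ 0<v)
  coin .value-injective {suc zero} {zero}     0≡v = contradiction 0≡v (ℚ.<⇒≢ 0<v)
  coin .value-injective {suc zero} {suc zero} _   = refl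
  coin .prob-pos zero    = 0<p
  coin .prob-pos (suc _) = p<q⇒0<q-p p<1
  coin .prob-sum = solve 1 (λ p → p :+ ((con 1ℚ :- p) :+ con 0ℚ) := con 1ℚ) refl p
    where open +-*-Solver

  mean-coin : mean coin ≡ p ℚ.* v
  mean-coin = solve 2 (λ p v → p :* v :+ ((con 1ℚ :- p) :* con 0ℚ :+ con 0ℚ) := p :* v) refl p v
    where open +-*-Solver

  -- The item cost is 0, so the reservation value is the largest reward.
  coin-reservationValue : IsReservationValue coin v
  coin-reservationValue = excess-v , least
    where
    open +-*-Solver
    excess-v : expectedExcess coin v ≡ 0ℚ
    excess-v = trans
      (cong₂ (λ x y → p ℚ.* x ℚ.+ ((1ℚ ℚ.- p) ℚ.* y ℚ.+ 0ℚ))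
        (cong (0ℚ ℚ.⊔_) (ℚ.+-inverseʳ v))
        (ℚ.p≥q⇒p⊔q≡p (ℚ.≤-trans (ℚ.≤-reflexive (ℚ.+-identityˡ (ℚ.- v)))
                                (ℚ.neg-antimono-≤ (ℚ.<⇒≤ 0<v)))))
      (solve 1 (λ p → p :* con 0ℚ :+ ((con 1ℚ :- p) :* con 0ℚ :+ con 0ℚ) := con 0ℚ) refl p)
    least : ∀ t → expectedExcess coin t ≡ 0ℚ → v ℚ.≤ t
    least t excess≡0 with ℚ.≤-total v t
    ... | inj₁ v≤t = v≤t
    ... | inj₂ t≤v with v ℚ.≤? t
    ...   | yes v≤t = v≤t
    -- Below `v` the winning outcome alone contributes `p ℚ.* (v ℚ.- t)`, which is positive.
    ...   | no  v≰t = contradiction (sym excess≡0) (ℚ.<⇒≢ (begin-strict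
      0ℚ
        <⟨ *-pos 0<p (p<q⇒0<q-p (ℚ.≰⇒> v≰t)) ⟩
      p ℚ.* (v ℚ.- t)
        ≡⟨ solve 2 (λ p x → p :* x := p :* x :+ ((con 1ℚ :- p) :* con 0ℚ :+ con 0ℚ))
             refl p (v ℚ.- t) ⟩
      p ℚ.* (v ℚ.- t) ℚ.+ ((1ℚ ℚ.- p) ℚ.* 0ℚ ℚ.+ 0ℚ)
        ≤⟨ ℚ.+-mono-≤ (*-monoˡ-prob coin zero (ℚ.p≤q⊔p 0ℚ (v ℚ.- t)))
             (ℚ.+-monoˡ-≤ 0ℚ (*-monoˡ-prob coin (suc zero) (ℚ.p≤p⊔q 0ℚ (0ℚ ℚ.- t)))) ⟩
      expectedExcess coin t ∎))
      where open ℚ.≤-Reasoning hiding (stop)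

-- Boxes in the order A, D, …, D, B

-- The bound `c`, later the total cost, is applied to each copy of `D`, while the indicator of the
-- last box is kept for the joint estimate of the two ends.
meanSum-replicate :
  ∀ k (D B : Box) (O : Fin (k ℕ.+ 1) → Bool) (c : ℚ) → (∀ i → indicator (O i) ℚ.≤ c) →
  meanSum (replicate k D ++ (B ∷ [])) O ℚ.≤
  k ⋆ mean D ℚ.* c ℚ.+ indicator (O (k ↑ʳ zero)) ℚ.* mean B
meanSum-replicate zero    D B O c O≤c = ℚ.≤-reflexive
  (solve 2 (λ x c → x :+ con 0ℚ := con 0ℚ :* c :+ x) refl (indicator (O zero) ℚ.* mean B) c)
  where open +-*-Solver
meanSum-replicate (suc k) D B O c O≤c = begin
  indicator (O zero) ℚ.* mean D ℚ.+ meanSum (replicate k D ++ (B ∷ [])) (O ∘ suc)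
    ≤⟨ ℚ.+-mono-≤
         (ℚ.*-monoʳ-≤-nonNeg (mean D) {{nonNegative (mean-nonneg D)}} (O≤c zero))
         (meanSum-replicate k D B (O ∘ suc) c (O≤c ∘ suc)) ⟩
  c ℚ.* mean D ℚ.+ (k ⋆ mean D ℚ.* c ℚ.+ indicator (O (suc k ↑ʳ zero)) ℚ.* mean B)
    ≡⟨ solve 4 (λ c d x y → c :* d :+ (x :* c :+ y) := (d :+ x) :* c :+ y) refl
         c (mean D) (k ⋆ mean D) (indicator (O (suc k ↑ʳ zero)) ℚ.* mean B) ⟩
  (mean D ℚ.+ k ⋆ mean D) ℚ.* c ℚ.+ indicator (O (suc k ↑ʳ zero)) ℚ.* mean B ∎
  where
  open ℚ.≤-Reasoning hiding (stop)
  open +-*-Solver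

k↑ʳzero-max : ∀ k (i : Fin (k ℕ.+ 1)) → i Fin.≤ k ↑ʳ zero {0}
k↑ʳzero-max k i = ℕ.≤-pred (subst (toℕ i ℕ.<_)
  (trans (ℕ.+-suc k 0) (cong suc (sym (Fin.toℕ-↑ʳ k (zero {0}))))) (Fin.toℕ<n i))

pairTail : ∀ k → Subset (k ℕ.+ 1)
pairTail k = replicate k false ++ (true ∷ [])

∣pairTail∣ : ∀ k → ∣ pairTail k ∣ ≡ 1
∣pairTail∣ zero    = refl
∣pairTail∣ (suc k) = ∣pairTail∣ k

itemCosts-pairTail : ∀ k D B → itemCosts (replicate k D ++ (B ∷ [])) (pairTail k) ≡ cost B ℚ.+ 0ℚ
itemCosts-pairTail zero    D B = refl
itemCosts-pairTail (suc k) D B = itemCosts-pairTail k D B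

-- The copies of `D` stay closed and integrate out to 1. The function `h` leaves room for the reward
-- of `A` and for the `0ℚ` of stopping.
𝔼-maxReward-pairTail : ∀ k D B (h : ℚ → ℚ) →
  𝔼 (replicate k D ++ (B ∷ []))
    (λ ω → h (maxReward (replicate k D ++ (B ∷ [])) (pairTail k) (observe ω (pairTail k)))) ≡
  sum (λ j → prob B j ℚ.* h (value B j ℚ.⊔ 0ℚ))
𝔼-maxReward-pairTail zero    D B h = refl
𝔼-maxReward-pairTail (suc k) D B h =
  trans (sum-prob-* D _) (𝔼-maxReward-pairTail k D B h)

module _ {k : ℕ} (A D B : Box) where

  row : Vec Box (suc (k ℕ.+ 1))
  row = A ∷ (replicate k D ++ (B ∷ []))

  -- By Wald's identity a pathwise bound on the means of the opened boxes suffices. The two ends, of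
  -- mean `μ` each, are charged together to the total cost; each copy of `D` is charged to it
  -- separately.
  𝔼reward-consecutive≤ : ∀ {μ} → mean A ≡ μ → mean B ≡ μ →
    (π : Policy k row ⊤) → Consecutive π →
    𝔼 row (reward π) ℚ.≤ (μ ℚ.+ k ⋆ mean D) ℚ.* 𝔼 row (totalCost 1ℚ π)
  𝔼reward-consecutive≤ {μ} refl mB≡μ π cons = begin
    𝔼 row (reward π)
      ≤⟨ 𝔼reward≤𝔼meanSum π ⟩
    𝔼 row (λ ω → meanSum row (opened π ω))
      ≤⟨ 𝔼-mono row pathwise ⟩
    𝔼 row (λ ω → totalCost 1ℚ π ω ℚ.* (μ ℚ.+ k ⋆ mean D))
      ≡⟨ 𝔼-*ʳ row (totalCost 1ℚ π) _ ⟩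
    𝔼 row (totalCost 1ℚ π) ℚ.* (μ ℚ.+ k ⋆ mean D)
      ≡⟨ ℚ.*-comm (𝔼 row (totalCost 1ℚ π)) _ ⟩
    (μ ℚ.+ k ⋆ mean D) ℚ.* 𝔼 row (totalCost 1ℚ π) ∎
    where
    open ℚ.≤-Reasoning hiding (stop)
    open +-*-Solver
    pathwise : ∀ ω → meanSum row (opened π ω) ℚ.≤ totalCost 1ℚ π ω ℚ.* (μ ℚ.+ k ⋆ mean D)
    pathwise ω = begin
      a ℚ.* μ ℚ.+ meanSum (replicate k D ++ (B ∷ [])) (opened π ω ∘ suc)
        ≤⟨ ℚ.+-monoʳ-≤ (a ℚ.* μ)
             (meanSum-replicate k D B (opened π ω ∘ suc) c (opened≤totalCost π ω ∘ suc)) ⟩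
      a ℚ.* μ ℚ.+ (k ⋆ mean D ℚ.* c ℚ.+ b ℚ.* mean B)
        ≡⟨ cong (λ m → a ℚ.* μ ℚ.+ (k ⋆ mean D ℚ.* c ℚ.+ b ℚ.* m)) mB≡μ ⟩
      a ℚ.* μ ℚ.+ (k ⋆ mean D ℚ.* c ℚ.+ b ℚ.* μ)
        ≡⟨ solve 4 (λ a b m x → a :* m :+ (x :+ b :* m) := (a :+ b) :* m :+ x) refl
             a b μ (k ⋆ mean D ℚ.* c) ⟩
      (a ℚ.+ b) ℚ.* μ ℚ.+ k ⋆ mean D ℚ.* c
        ≤⟨ ℚ.+-monoˡ-≤ (k ⋆ mean D ℚ.* c)
             (ℚ.*-monoʳ-≤-nonNeg μ {{nonNegative (mean-nonneg A)}}
               (consecutive-ends≤totalCost (k↑ʳzero-max k) (ℕ.m≤m+n k 1) π cons ω)) ⟩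
      c ℚ.* μ ℚ.+ k ⋆ mean D ℚ.* c
        ≡⟨ solve 3 (λ c m x → c :* m :+ x :* c := c :* (m :+ x)) refl c μ (k ⋆ mean D) ⟩
      c ℚ.* (μ ℚ.+ k ⋆ mean D) ∎
      where
      a = indicator (opened π ω zero)
      b = indicator (opened π ω (suc (k ↑ʳ zero)))
      c = totalCost 1ℚ π ω

  -- The competitor that is not consecutive: its single batch skips all copies of `D`.
  openEnds : 2 ℕ.≤ k → Policy k row ⊤
  openEnds 2≤k = openBatch (true ∷ pairTail k)
    ( (zero , lookup⇒[]= zero (true ∷ pairTail k) refl)
    , (λ _ → Subset.∈⊤)
    , subst (ℕ._≤ k) (cong suc (sym (∣pairTail∣ k))) 2≤k)
    λ _ → stop

  value₁-openEnds : (2≤k : 2 ℕ.≤ k) →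
    value₁ (openEnds 2≤k) ≡
    sum (λ i → prob A i ℚ.* sum (λ j → prob B j ℚ.* ((value A i ℚ.⊔ (value B j ℚ.⊔ 0ℚ)) ℚ.⊔ 0ℚ)))
    ℚ.- ((1ℚ ℚ.+ (cost A ℚ.+ (cost B ℚ.+ 0ℚ))) ℚ.+ 0ℚ)
  value₁-openEnds _ = cong₂ ℚ._-_
    (sum-cong-≗ λ i → cong (prob A i ℚ.*_)
      (𝔼-maxReward-pairTail k D B λ x → (value A i ℚ.⊔ x) ℚ.⊔ 0ℚ))
    (trans (𝔼-const row _)
      (cong (λ x → (1ℚ ℚ.+ (cost A ℚ.+ x)) ℚ.+ 0ℚ) (itemCosts-pairTail k D B)))

  row-sorted : ∀ {a d b} → IsReservationValue A a → IsReservationValue D d →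
               IsReservationValue B b → d ℚ.≤ a → b ℚ.≤ d → Sorted row
  row-sorted {a} {d} {b} rA rD rB d≤a b≤d = σ , σ-reservation , σ-decreasing
    where
    σ′ : ∀ m → Fin (m ℕ.+ 1) → ℚ
    σ′ zero    _       = b
    σ′ (suc m) zero    = d
    σ′ (suc m) (suc i) = σ′ m i
    σ : Fin (suc (k ℕ.+ 1)) → ℚ
    σ zero    = a
    σ (suc i) = σ′ k i
    σ′-reservation : ∀ m i → IsReservationValue (lookup (replicate m D ++ (B ∷ [])) i) (σ′ m i)
    σ′-reservation zero    zero    = rB
    σ′-reservation (suc m) zero    = rD
    σ′-reservation (suc m) (suc i) = σ′-reservation m i
    σ-reservation : ∀ i → IsReservationValue (lookup row i) (σ i)
    σ-reservation zero    = rA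
    σ-reservation (suc i) = σ′-reservation k i
    σ′≤d : ∀ m i → σ′ m i ℚ.≤ d
    σ′≤d zero    _       = b≤d
    σ′≤d (suc m) zero    = ℚ.≤-refl
    σ′≤d (suc m) (suc i) = σ′≤d m i
    σ′-decreasing : ∀ m i j → i Fin.≤ j → σ′ m j ℚ.≤ σ′ m i
    σ′-decreasing zero    _       _       _         = ℚ.≤-refl
    σ′-decreasing (suc m) zero    j       _         = σ′≤d (suc m) j
    σ′-decreasing (suc m) (suc i) (suc j) (s≤s i≤j) = σ′-decreasing m i j i≤j
    σ-decreasing : ∀ i j → i Fin.≤ j → σ j ℚ.≤ σ i
    σ-decreasing zero    zero    _         = ℚ.≤-refl
    σ-decreasing zero    (suc j) _         = ℚ.≤-trans (σ′≤d k j) d≤a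
    σ-decreasing (suc i) (suc j) (s≤s i≤j) = σ′-decreasing k i j i≤j

value₁-openEnds-coins :
  ∀ a p 0<a 0<p p<1 b r 0<b 0<r r<1 (D : Box) → b ℚ.≤ a → (2≤k : 2 ℕ.≤ k) →
  value₁ (openEnds (coin a p 0<a 0<p p<1) D (coin b r 0<b 0<r r<1) 2≤k) ≡
  (p ℚ.* a ℚ.+ (1ℚ ℚ.- p) ℚ.* (r ℚ.* b)) ℚ.- 1ℚ
value₁-openEnds-coins a p 0<a 0<p p<1 b r 0<b 0<r r<1 D b≤a 2≤k = begin
  value₁ (openEnds A D B 2≤k)
    ≡⟨ value₁-openEnds A D B 2≤k ⟩
  -- The maxima when both coins win, only `A` wins, or only `B` wins; the fourth computes to `0ℚ`.
  -- Since `b ≤ a`, the coin `B` matters only when `A` loses.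
  expand ((a ℚ.⊔ (b ℚ.⊔ 0ℚ)) ℚ.⊔ 0ℚ) ((a ℚ.⊔ 0ℚ) ℚ.⊔ 0ℚ) ((0ℚ ℚ.⊔ (b ℚ.⊔ 0ℚ)) ℚ.⊔ 0ℚ)
    ≡⟨ cong₂ (λ x y → expand x y ((0ℚ ℚ.⊔ (b ℚ.⊔ 0ℚ)) ℚ.⊔ 0ℚ)) a⊔b a⊔0 ⟩
  expand a a ((0ℚ ℚ.⊔ (b ℚ.⊔ 0ℚ)) ℚ.⊔ 0ℚ)
    ≡⟨ cong (expand a a) 0⊔b ⟩
  expand a a b
    ≡⟨ solve 4 (λ a p b r →
         (p :* (r :* a :+ ((con 1ℚ :- r) :* a :+ con 0ℚ)) :+
         ((con 1ℚ :- p) :* (r :* b :+ ((con 1ℚ :- r) :* con 0ℚ :+ con 0ℚ)) :+ con 0ℚ)) :-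
         ((con 1ℚ :+ (con 0ℚ :+ (con 0ℚ :+ con 0ℚ))) :+ con 0ℚ) :=
         (p :* a :+ (con 1ℚ :- p) :* (r :* b)) :- con 1ℚ) refl a p b r ⟩
  (p ℚ.* a ℚ.+ (1ℚ ℚ.- p) ℚ.* (r ℚ.* b)) ℚ.- 1ℚ ∎
  where
  open ≡-Reasoning
  open +-*-Solver
  A B : Box
  A = coin a p 0<a 0<p p<1
  B = coin b r 0<b 0<r r<1
  expand : ℚ → ℚ → ℚ → ℚ
  expand x y z =
    (p ℚ.* (r ℚ.* x ℚ.+ ((1ℚ ℚ.- r) ℚ.* y ℚ.+ 0ℚ)) ℚ.+
    ((1ℚ ℚ.- p) ℚ.* (r ℚ.* z ℚ.+ ((1ℚ ℚ.- r) ℚ.* 0ℚ ℚ.+ 0ℚ)) ℚ.+ 0ℚ)) ℚ.-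
    ((1ℚ ℚ.+ (0ℚ ℚ.+ (0ℚ ℚ.+ 0ℚ))) ℚ.+ 0ℚ)
  a⊔0ˡ : a ℚ.⊔ 0ℚ ≡ a
  a⊔0ˡ = ℚ.p≥q⇒p⊔q≡p (ℚ.<⇒≤ 0<a)
  b⊔0 : b ℚ.⊔ 0ℚ ≡ b
  b⊔0 = ℚ.p≥q⇒p⊔q≡p (ℚ.<⇒≤ 0<b)
  a⊔0 : (a ℚ.⊔ 0ℚ) ℚ.⊔ 0ℚ ≡ a
  a⊔0 = trans (cong (ℚ._⊔ 0ℚ) a⊔0ˡ) a⊔0ˡ
  a⊔b : (a ℚ.⊔ (b ℚ.⊔ 0ℚ)) ℚ.⊔ 0ℚ ≡ a
  a⊔b = trans (cong (ℚ._⊔ 0ℚ) (trans (cong (a ℚ.⊔_) b⊔0) (ℚ.p≥q⇒p⊔q≡p b≤a))) a⊔0ˡ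
  0⊔b : (0ℚ ℚ.⊔ (b ℚ.⊔ 0ℚ)) ℚ.⊔ 0ℚ ≡ b
  0⊔b = trans (cong (ℚ._⊔ 0ℚ) (trans (cong (0ℚ ℚ.⊔_) b⊔0) (ℚ.p≤q⇒p⊔q≡q (ℚ.<⇒≤ 0<b)))) b⊔0

-- Real-valued optima

eventually-≤ : ∀ x y N → (∀ i → N ℕ.≤ i → seq x i ℚ.≤ seq y i) → x ≤ y
eventually-≤ x y N x≤y δ 0<δ = N , λ i N≤i → ℚ.≤-trans (x≤y i N≤i)
  (subst (ℚ._≤ seq y i ℚ.+ δ) (ℚ.+-identityʳ (seq y i))
    (ℚ.+-monoʳ-≤ (seq y i) (ℚ.<⇒≤ 0<δ)))

isOPT₁-value₁ : {bs : Vec Box n} (π : Policy k bs ⊤) → (∀ ρ → value₁ ρ ℚ.≤ value₁ π) →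
                IsOPT₁ 1ℚ k bs (fromℚ (value₁ π))
isOPT₁-value₁ {bs = bs} π max =
    (π , eventually-≤ (val 1ℚ 1ℝ π) o 0 (λ _ _ → ℚ.≤-reflexive (1* π))
       , eventually-≤ o (val 1ℚ 1ℝ π) 0 (λ _ _ → ℚ.≤-reflexive (sym (1* π))))
  , λ ρ → eventually-≤ (val 1ℚ 1ℝ ρ) o 0 λ _ _ → ℚ.≤-trans (ℚ.≤-reflexive (1* ρ)) (max ρ)
  where
  o : ℝ
  o = fromℚ (value₁ π)
  1* : ∀ ρ → 𝔼 bs (reward ρ) ℚ.- 1ℚ ℚ.* 𝔼 bs (totalCost 1ℚ ρ) ≡ value₁ ρ
  1* ρ = cong (λ c → 𝔼 bs (reward ρ) ℚ.- c) (ℚ.*-identityˡ (𝔼 bs (totalCost 1ℚ ρ)))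

profitable⇒0<OPT₁ : {bs : Vec Box n} (ρ : Policy k bs ⊤) → 0ℚ ℚ.< value₁ ρ →
                    ∃[ o ] (IsOPT₁ 1ℚ k bs o × 0ℝ < o)
profitable⇒0<OPT₁ {k = k} {bs = bs} ρ 0<ρ =
    fromℚ (value₁ best) , isOPT₁-value₁ best best-max
  , value₁ best , ℚ.<-≤-trans 0<ρ (best-max ρ)
  , 0 , λ _ _ → ℚ.≤-reflexive (ℚ.+-identityˡ (value₁ best))
  where
  best : Policy k bs ⊤
  best = proj₁ optimalPolicy
  best-max : ∀ π → value₁ π ℚ.≤ value₁ best
  best-max = proj₂ optimalPolicy

-- Parameters of the instance

-- Half of the budget covers one copy and the other half covers the rest, so the witness is `η`
-- halved `k` times.
split-mass : ∀ k {η} d → 0ℚ ℚ.< η → 0ℚ ℚ.≤ d →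
             ∃[ q ] (0ℚ ℚ.< q × q ℚ.≤ η × k ⋆ (q ℚ.* d) ℚ.≤ η ℚ.* d)
split-mass zero    {η} d 0<η 0≤d = η , 0<η , ℚ.≤-refl
  , ℚ.nonNegative⁻¹ (η ℚ.* d)
      {{ℚ.nonNeg*nonNeg⇒nonNeg η {{nonNegative (ℚ.<⇒≤ 0<η)}} d {{nonNegative 0≤d}}}}
split-mass (suc k) {η} d 0<η 0≤d =
  let (q , 0<q , q≤½η , k⋆≤) = split-mass k d 0<½η 0≤d
  in q , 0<q , ℚ.≤-trans q≤½η ½η≤η , (begin
    q ℚ.* d ℚ.+ k ⋆ (q ℚ.* d)
      ≤⟨ ℚ.+-mono-≤ (ℚ.*-monoʳ-≤-nonNeg d {{nonNegative 0≤d}} q≤½η) k⋆≤ ⟩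
    ½ ℚ.* η ℚ.* d ℚ.+ ½ ℚ.* η ℚ.* d
      ≡⟨ solve 2 (λ η d → con ½ :* η :* d :+ con ½ :* η :* d := η :* d) refl η d ⟩
    η ℚ.* d ∎)
  where
  open ℚ.≤-Reasoning hiding (stop)
  open +-*-Solver
  0<½η : 0ℚ ℚ.< ½ ℚ.* η
  0<½η = *-pos (ℚ.positive⁻¹ ½) 0<η
  ½η≤η : ½ ℚ.* η ℚ.≤ η
  ½η≤η = ℚ.<⇒≤ (p+q≡r⇒p<r 0<½η (solve 1 (λ η → con ½ :* η :+ con ½ :* η := η) refl η))

¼ : ℚ
¼ = ½ ℚ.* ½

module Instance (k : ℕ) (2≤k : 2 ℕ.≤ k) (δ : ℚ) (0<δ : 0ℚ ℚ.< δ) (δ≤¼ : δ ℚ.≤ ¼) where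

  open ℚ.≤-Reasoning hiding (stop)
  open +-*-Solver using (solve; _:+_; _:*_; _:-_; _:=_; con)

  instance
    δ⁺ : ℚ.Positive δ
    δ⁺ = positive 0<δ
    δ≢0 : ℚ.NonZero δ
    δ≢0 = ℚ.pos⇒nonZero δ

  -- `A` and `B` share the mean `μ`: `B` pays `b`, twice `μ`, with probability `½`, and `A` pays `a`
  -- with probability `δ`. The value `d`, three times `μ`, lies between `b` and `a` because `δ ≤ ¼`.
  μ a d b : ℚ
  μ = ½ ℚ.+ δ
  b = μ ℚ.+ μ
  d = b ℚ.+ μ
  a = ℚ.1/ δ ℚ.* μ

  0<μ : 0ℚ ℚ.< μ
  0<μ = ℚ.+-mono-< (ℚ.positive⁻¹ ½) 0<δ

  0<b : 0ℚ ℚ.< b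
  0<b = ℚ.+-mono-< 0<μ 0<μ

  0<d : 0ℚ ℚ.< d
  0<d = ℚ.+-mono-< 0<b 0<μ

  ½<1 : ½ ℚ.< 1ℚ
  ½<1 = toWitness {a? = ½ ℚ.<? 1ℚ} _

  b<d : b ℚ.< d
  b<d = p+q≡r⇒p<r 0<μ refl

  δa≡μ : δ ℚ.* a ≡ μ
  δa≡μ = trans (sym (ℚ.*-assoc δ (ℚ.1/ δ) μ))
    (trans (cong (ℚ._* μ) (ℚ.*-inverseʳ δ)) (ℚ.*-identityˡ μ))

  d<a : d ℚ.< a
  d<a = ℚ.*-cancelˡ-<-nonNeg δ {{ℚ.pos⇒nonNeg δ}} (begin-strict
    δ ℚ.* d ≤⟨ ℚ.*-monoʳ-≤-nonNeg d {{nonNegative (ℚ.<⇒≤ 0<d)}} δ≤¼ ⟩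
    ¼ ℚ.* d <⟨ p+q≡r⇒p<r (*-pos (ℚ.positive⁻¹ ¼) 0<μ)
                 (solve 1 (λ m → con ¼ :* (m :+ m :+ m) :+ con ¼ :* m := m) refl μ) ⟩
    μ       ≡⟨ δa≡μ ⟨
    δ ℚ.* a ∎)

  0<a : 0ℚ ℚ.< a
  0<a = ℚ.<-trans 0<d d<a

  ½b≡μ : ½ ℚ.* b ≡ μ
  ½b≡μ = solve 1 (λ m → con ½ :* (m :+ m) := m) refl μ

  μ≤1 : μ ℚ.≤ 1ℚ
  μ≤1 = ℚ.≤-trans (ℚ.+-monoʳ-≤ ½ δ≤¼) (toWitness {a? = (½ ℚ.+ ¼) ℚ.≤? 1ℚ} _)

  δ<1 : δ ℚ.< 1ℚ
  δ<1 = ℚ.≤-<-trans δ≤¼ (toWitness {a? = ¼ ℚ.<? 1ℚ} _)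

  -- With the budget `¼ ℚ.* δ` the total mean of the copies is at most three quarters of `μ ℚ.* δ`,
  -- hence at most `δ`.
  mass : ∃[ q ] (0ℚ ℚ.< q × q ℚ.≤ ¼ ℚ.* δ × k ⋆ (q ℚ.* d) ℚ.≤ ¼ ℚ.* δ ℚ.* d)
  mass = split-mass k d (*-pos (ℚ.positive⁻¹ ¼) 0<δ) (ℚ.<⇒≤ 0<d)

  q : ℚ
  q = proj₁ mass

  0<q : 0ℚ ℚ.< q
  0<q = proj₁ (proj₂ mass)

  q<1 : q ℚ.< 1ℚ
  q<1 = begin-strict
    q       ≤⟨ proj₁ (proj₂ (proj₂ mass)) ⟩
    ¼ ℚ.* δ ≤⟨ ℚ.*-monoʳ-≤-nonNeg δ {{ℚ.pos⇒nonNeg δ}} (toWitness {a? = ¼ ℚ.≤? 1ℚ} _) ⟩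
    1ℚ ℚ.* δ ≡⟨ ℚ.*-identityˡ δ ⟩
    δ       <⟨ δ<1 ⟩
    1ℚ ∎

  A D B : Box
  A = coin a δ 0<a 0<δ δ<1
  D = coin d q 0<d 0<q q<1
  B = coin b ½ 0<b (ℚ.positive⁻¹ ½) ½<1

  boxes : Vec Box (suc (k ℕ.+ 1))
  boxes = row {k} A D B

  mean-A : mean A ≡ μ
  mean-A = trans (mean-coin a δ 0<a 0<δ δ<1) δa≡μ

  mean-B : mean B ≡ μ
  mean-B = trans (mean-coin b ½ 0<b (ℚ.positive⁻¹ ½) ½<1) ½b≡μ

  k⋆mean-D≤δ : k ⋆ mean D ℚ.≤ δ
  k⋆mean-D≤δ = begin
    k ⋆ mean D     ≡⟨ cong (k ⋆_) (mean-coin d q 0<d 0<q q<1) ⟩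
    k ⋆ (q ℚ.* d)  ≤⟨ proj₂ (proj₂ (proj₂ mass)) ⟩
    ¼ ℚ.* δ ℚ.* d  ≤⟨ ℚ.<⇒≤ (p+q≡r⇒p<r (*-pos (*-pos (ℚ.positive⁻¹ ¼) 0<δ) 0<μ)
      (solve 2 (λ m δ → con ¼ :* δ :* (m :+ m :+ m) :+ con ¼ :* δ :* m := m :* δ) refl μ δ)) ⟩
    μ ℚ.* δ        ≤⟨ ℚ.*-monoʳ-≤-nonNeg δ {{ℚ.pos⇒nonNeg δ}} μ≤1 ⟩
    1ℚ ℚ.* δ       ≡⟨ ℚ.*-identityˡ δ ⟩
    δ ∎

  𝔼reward≤ : (π : Policy k boxes ⊤) → Consecutive π →
             𝔼 boxes (reward π) ℚ.≤ (½ ℚ.+ (δ ℚ.+ δ)) ℚ.* 𝔼 boxes (totalCost 1ℚ π)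
  𝔼reward≤ π cons = ℚ.≤-trans (𝔼reward-consecutive≤ A D B mean-A mean-B π cons)
    (ℚ.*-monoʳ-≤-nonNeg (𝔼 boxes (totalCost 1ℚ π))
      {{nonNegative (𝔼totalCost-nonneg π)}}
      (ℚ.≤-trans (ℚ.+-monoʳ-≤ μ k⋆mean-D≤δ) (ℚ.≤-reflexive (ℚ.+-assoc ½ δ δ))))

  value₁-ends : value₁ (openEnds A D B 2≤k) ≡ (μ ℚ.+ (1ℚ ℚ.- δ) ℚ.* μ) ℚ.- 1ℚ
  value₁-ends = trans
    (value₁-openEnds-coins a δ 0<a 0<δ δ<1 b ½ 0<b (ℚ.positive⁻¹ ½) ½<1 D b≤a 2≤k)
    (cong (ℚ._- 1ℚ) (cong₂ (λ x y → x ℚ.+ (1ℚ ℚ.- δ) ℚ.* y) δa≡μ ½b≡μ))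
    where
    b≤a : b ℚ.≤ a
    b≤a = ℚ.<⇒≤ (ℚ.<-trans b<d d<a)

  -- The value equals `(δ ℚ.+ δ) ℚ.- μ ℚ.* δ`, which is at least `δ` because `μ ≤ 1`.
  ends-profitable : 0ℚ ℚ.< value₁ (openEnds A D B 2≤k)
  ends-profitable = begin-strict
    0ℚ
      <⟨ 0<δ ⟩
    δ
      ≡⟨ solve 1 (λ δ → δ := (δ :+ δ) :- con 1ℚ :* δ) refl δ ⟩
    (δ ℚ.+ δ) ℚ.- 1ℚ ℚ.* δ
      ≤⟨ ℚ.+-monoʳ-≤ (δ ℚ.+ δ) (ℚ.neg-antimono-≤ (ℚ.*-monoʳ-≤-nonNeg δ {{ℚ.pos⇒nonNeg δ}} μ≤1)) ⟩
    (δ ℚ.+ δ) ℚ.- μ ℚ.* δ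
      ≡⟨ solve 1 (λ δ → (δ :+ δ) :- (con ½ :+ δ) :* δ :=
           ((con ½ :+ δ) :+ (con 1ℚ :- δ) :* (con ½ :+ δ)) :- con 1ℚ) refl δ ⟩
    (μ ℚ.+ (1ℚ ℚ.- δ) ℚ.* μ) ℚ.- 1ℚ
      ≡⟨ value₁-ends ⟨
    value₁ (openEnds A D B 2≤k) ∎

  reservation-A : IsReservationValue A a
  reservation-A = coin-reservationValue a δ 0<a 0<δ δ<1

  reservation-D : IsReservationValue D d
  reservation-D = coin-reservationValue d q 0<d 0<q q<1

  reservation-B : IsReservationValue B b
  reservation-B = coin-reservationValue b ½ 0<b (ℚ.positive⁻¹ ½) ½<1

  sorted : Sorted boxes
  sorted = row-sorted {k} A D B reservation-A reservation-D reservation-B (ℚ.<⇒≤ d<a) (ℚ.<⇒≤ b<d)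

  A≻D : A ≻ D
  A≻D = a , d , reservation-A , reservation-D , d<a

  D≻B : D ≻ B
  D≻B = d , b , reservation-D , reservation-B , b<d

  val-nonpositive : ∀ α N → (∀ i → N ℕ.≤ i → ½ ℚ.+ (δ ℚ.+ δ) ℚ.≤ seq α i) →
                    (π : Policy k boxes ⊤) → Consecutive π → val 1ℚ α π ≤ 0ℝ
  val-nonpositive α N ½+2δ≤α π cons = eventually-≤ (val 1ℚ α π) 0ℝ N λ i N≤i → begin
    R ℚ.- seq α i ℚ.* C
      ≤⟨ ℚ.+-monoˡ-≤ (ℚ.- (seq α i ℚ.* C)) (ℚ.≤-trans (𝔼reward≤ π cons)
           (ℚ.*-monoʳ-≤-nonNeg C {{nonNegative (𝔼totalCost-nonneg π)}} (½+2δ≤α i N≤i))) ⟩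
    seq α i ℚ.* C ℚ.- seq α i ℚ.* C
      ≡⟨ ℚ.+-inverseʳ (seq α i ℚ.* C) ⟩
    0ℚ ∎
    where
    R C : ℚ
    R = 𝔼 boxes (reward π)
    C = 𝔼 boxes (totalCost 1ℚ π)

-- Separation and the failure of guarantees

Separation : ℕ → ℝ → Set
Separation k α =
  Σ[ A ∈ Box ] Σ[ D ∈ Box ] Σ[ B ∈ Box ]
  (let bs = row {k} A D B in
   Sorted bs × A ≻ D × D ≻ B ×
   ((π : Policy k bs ⊤) → Consecutive π → val 1ℚ α π ≤ 0ℝ) ×
   (∃[ o ] (IsOPT₁ 1ℚ k bs o × 0ℝ < o)))

instance⇒separation : (k : ℕ) → 2 ℕ.≤ k → (δ : ℚ) → 0ℚ ℚ.< δ → δ ℚ.≤ ¼ →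
  ∀ α N → (∀ i → N ℕ.≤ i → ½ ℚ.+ (δ ℚ.+ δ) ℚ.≤ seq α i) → Separation k α
instance⇒separation k 2≤k δ 0<δ δ≤¼ α N ½+2δ≤α =
  A , D , B , sorted , A≻D , D≻B , val-nonpositive α N ½+2δ≤α
    , profitable⇒0<OPT₁ (openEnds A D B 2≤k) ends-profitable
  where open Instance k 2≤k δ 0<δ δ≤¼

separation : (k : ℕ) → 2 ℕ.≤ k → (α : ℝ) → fromℚ ½ < α → Separation k α
separation k 2≤k α (ε , 0<ε , N , ½+ε≤α) =
  instance⇒separation k 2≤k δ 0<δ (ℚ.p⊓q≤q (½ ℚ.* ε) ¼) α N
    λ i N≤i → ℚ.≤-trans (ℚ.+-monoʳ-≤ ½ 2δ≤ε) (½+ε≤α i N≤i)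
  where
  open +-*-Solver
  δ : ℚ
  -- Half of the gap `ε` between `½` and `α` gives `½ + 2δ ≤ α`; the cap `¼` keeps `d` below `a`.
  δ = ½ ℚ.* ε ℚ.⊓ ¼
  0<δ : 0ℚ ℚ.< δ
  0<δ with ℚ.⊓-sel (½ ℚ.* ε) ¼
  ... | inj₁ δ≡½ε = subst (0ℚ ℚ.<_) (sym δ≡½ε) (*-pos (ℚ.positive⁻¹ ½) 0<ε)
  ... | inj₂ δ≡¼  = subst (0ℚ ℚ.<_) (sym δ≡¼) (ℚ.positive⁻¹ ¼)
  2δ≤ε : δ ℚ.+ δ ℚ.≤ ε
  2δ≤ε = ℚ.≤-trans (ℚ.+-mono-≤ (ℚ.p⊓q≤p (½ ℚ.* ε) ¼) (ℚ.p⊓q≤p (½ ℚ.* ε) ¼))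
    (ℚ.≤-reflexive (solve 1 (λ ε → con ½ :* ε :+ con ½ :* ε := ε) refl ε))

-- The product `α * o` stays above half of the gap `ρ` between 0 and `o`, so a small enough `ε`
-- contradicts a non-positive value.
guarantee⇒⊥ : ∀ α o (v : (ε : ℝ) → 0ℝ < ε → ℝ) → fromℚ ½ < α → 0ℝ < o →
  (∀ ε 0<ε → v ε 0<ε ≤ 0ℝ) → ¬ (∀ ε 0<ε → α * o - ε ≤ v ε 0<ε)
guarantee⇒⊥ α o v (η , 0<η , N₁ , ½+η≤α) (ρ , 0<ρ , N₂ , 0+ρ≤o) v≤0 guarantee =
  let (N₃ , v≤ε)  = v≤0 (fromℚ ε) 0<εℝ ε 0<ε
      (N₄ , αo≤v) = guarantee (fromℚ ε) 0<εℝ ε 0<ε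
      M           = (N₁ ℕ.+ N₂) ℕ.+ (N₃ ℕ.+ N₄)
      M₁₂         = ℕ.m≤m+n (N₁ ℕ.+ N₂) (N₃ ℕ.+ N₄)
      M₃₄         = ℕ.m≤n+m (N₃ ℕ.+ N₄) (N₁ ℕ.+ N₂)
  in bound (seq α M) (seq o M) (seq (v (fromℚ ε) 0<εℝ) M)
       (½+η≤α M (ℕ.≤-trans (ℕ.m≤m+n N₁ N₂) M₁₂)) (0+ρ≤o M (ℕ.≤-trans (ℕ.m≤n+m N₂ N₁) M₁₂))
       (v≤ε M (ℕ.≤-trans (ℕ.m≤m+n N₃ N₄) M₃₄)) (αo≤v M (ℕ.≤-trans (ℕ.m≤n+m N₄ N₃) M₃₄))
  where
  open ℚ.≤-Reasoning hiding (stop)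
  open +-*-Solver
  ε : ℚ
  -- Three errors `ε` add up: that of the guarantee, and the slack in each of the two real
  -- inequalities. Four of them make `½ ℚ.* ρ`, so the contradiction is strict.
  ε = ¼ ℚ.* (½ ℚ.* ρ)
  0<ε : 0ℚ ℚ.< ε
  0<ε = *-pos (ℚ.positive⁻¹ ¼) (*-pos (ℚ.positive⁻¹ ½) 0<ρ)
  0<εℝ : 0ℝ < fromℚ ε
  0<εℝ = ε , 0<ε , 0 , λ _ _ → ℚ.≤-reflexive (ℚ.+-identityˡ ε)
  bound : ∀ x y z → ½ ℚ.+ η ℚ.≤ x → 0ℚ ℚ.+ ρ ℚ.≤ y → z ℚ.≤ 0ℚ ℚ.+ ε →
          ¬ (x ℚ.* y ℚ.- ε ℚ.≤ z ℚ.+ ε)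
  bound x y z ½+η≤x ρ≤y z≤ε xy≤z = ℚ.<-irrefl refl (begin-strict
    ε ℚ.+ ε ℚ.+ ε ℚ.+ 0ℚ
      <⟨ ℚ.+-monoʳ-< (ε ℚ.+ ε ℚ.+ ε) 0<ε ⟩
    ε ℚ.+ ε ℚ.+ ε ℚ.+ ε
      ≡⟨ solve 1 (λ ρ → let e = con ¼ :* (con ½ :* ρ) in
           e :+ e :+ e :+ e := con ½ :* (con 0ℚ :+ ρ)) refl ρ ⟩
    ½ ℚ.* (0ℚ ℚ.+ ρ)
      ≤⟨ ℚ.*-monoˡ-≤-nonNeg ½ ρ≤y ⟩
    ½ ℚ.* y
      ≤⟨ ℚ.*-monoʳ-≤-nonNeg y {{nonNegative 0≤y}} ½≤x ⟩
    x ℚ.* y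
      ≡⟨ solve 2 (λ p e → p := (p :- e) :+ e) refl (x ℚ.* y) ε ⟩
    (x ℚ.* y ℚ.- ε) ℚ.+ ε
      ≤⟨ ℚ.+-monoˡ-≤ ε (ℚ.≤-trans xy≤z (ℚ.+-monoˡ-≤ ε z≤ε)) ⟩
    0ℚ ℚ.+ ε ℚ.+ ε ℚ.+ ε
      ≡⟨ solve 1 (λ e → con 0ℚ :+ e :+ e :+ e := e :+ e :+ e :+ con 0ℚ) refl ε ⟩
    ε ℚ.+ ε ℚ.+ ε ℚ.+ 0ℚ ∎)
    where
    0≤y : 0ℚ ℚ.≤ y
    0≤y = ℚ.≤-trans (ℚ.<⇒≤ 0<ρ) (ℚ.≤-trans (ℚ.≤-reflexive (sym (ℚ.+-identityˡ ρ))) ρ≤y)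
    ½≤x : ½ ℚ.≤ x
    ½≤x = ℚ.≤-trans (ℚ.<⇒≤ (p+q≡r⇒p<r 0<η refl)) ½+η≤x

theoremA1 :
  (k : ℕ) → 2 ℕ.≤ k →
  ((α : ℝ) → fromℚ ½ < α → α ≤ 1ℝ →
    Σ[ A ∈ Box ] Σ[ D ∈ Box ] Σ[ B ∈ Box ]
    (let bs : Vec Box (suc (k ℕ.+ 1))
         bs = A ∷ (replicate k D ++ (B ∷ [])) in
     Sorted bs × A ≻ D × D ≻ B ×
     ((π : Policy k bs ⊤) → Consecutive π → val 1ℚ α π ≤ 0ℝ) ×
     (∃[ o ] (IsOPT₁ 1ℚ k bs o × 0ℝ < o))))
  ×
  ((α : ℝ) → fromℚ ½ < α →
    (alg : ConsecutiveAlgorithm k) → ¬ BicriteriaGuarantee 1ℚ α α alg)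
theoremA1 k 2≤k =
    (λ α ½<α _ → separation k 2≤k α ½<α)
  , λ α ½<α alg guarantee →
      let (A , D , B , sorted , _ , _ , nonpositive , o , opt , 0<o) = separation k 2≤k α ½<α
          bs = row A D B
      in guarantee⇒⊥ α o (λ ε 0<ε → val 1ℚ α (proj₁ (alg bs sorted ε 0<ε))) ½<α 0<o
           (λ ε 0<ε → nonpositive (proj₁ (alg bs sorted ε 0<ε)) (proj₂ (alg bs sorted ε 0<ε)))
           (λ ε 0<ε → guarantee bs sorted ε 0<ε o opt)
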